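{- Let $\mathcal{L}_0$ and $\mathcal{L}_1$ be computable linear orders and let $C\subseteq\omega$ be a cohesive set. Then the following hold. (1) $\Pi_C(\mathcal{L}_0+\mathcal{L}_1)\cong \Pi_C\mathcal{L}_0+\Pi_C\mathcal{L}_1$. (2) $\Pi_C(\mathcal{L}_0\times\mathcal{L}_1)\cong \Pi_C\mathcal{L}_0\times\Pi_C\mathcal{L}_1$. (3) $\Pi_C(\mathcal{L}_0^{rev})\cong(\Pi_C\mathcal{L}_0)^{rev}$. (4) If $\mathcal{A}$ is a computable presentation of the linear order $\mathbb{N}$ (that is, a computable linear order isomorphic to $\mathbb{N}$) whose successor function is computable, then $\Pi_C\mathcal{A}\cong\mathbb{N}+\mathbb{Q}\times\mathbb{Z}$. (5) If $\mathcal{L}$ is a computable dense linear order without endpoints, then $\mathcal{L}\cong\Pi_C\mathcal{L}$.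
   Context: $\omega$ denotes the set of natural numbers. $X\subseteq^* Y$ means that $X\setminus Y$ is finite. An infinite set $C\subseteq\omega$ is cohesive if for every c.e. set $W$, either $W\cap C$ or $\overline{W}\cap C$ is finite. Linear orders are strict and nonempty. A computable linear order $\mathcal{L}=(L,<_{\mathcal{L}})$ is one whose domain $L$ is a computable subset of $\omega$ and whose relation $<_{\mathcal{L}}$ is computable. Cohesive power: for a cohesive set $C$ and a computable linear order $\mathcal{L}=(L,<_{\mathcal{L}})$, let $D$ be the set of partial computable functions $\varphi:\omega\to L$ with $C\subseteq^*\mathrm{dom}(\varphi)$. For $\varphi,\psi\in D$ put $\varphi=_C\psi$ iff $C\subseteq^*\{x:\varphi(x){\downarrow}=\psi(x){\downarrow}\}$. The cohesive power $\Pi_C\mathcal{L}$ has domain $D/{=_C}$, with $[\varphi]<[\psi]$ iff $C\subseteq^*\{x:\varphi(x){\downarrow}<_{\mathcal{L}}\psi(x){\downarrow}\}$. Operations on linear orders $\mathcal{L}_0=(L_0,<_{\mathcal{L}_0})$ and $\mathcal{L}_1=(L_1,<_{\mathcal{L}_1})$: the sum $\mathcal{L}_0+\mathcal{L}_1$ has domain $\{\langle 0,l\rangle:l\in L_0\}\cup\{\langle 1,l\rangle:l\in L_1\}$ with $\langle i,l\rangle<\langle j,m\rangle$ iff $i<j$, or $i=j$ and $l<_{\mathcal{L}_i}m$. The lexicographical product $\mathcal{L}_0\times\mathcal{L}_1$ has domain $L_0\times L_1$ with $\langle k,m\rangle<\langle l,n\rangle$ iff $k<_{\mathcal{L}_0}l$,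 or $k=l$ and $m<_{\mathcal{L}_1}n$ (so the first coordinate is the most significant). $\mathcal{L}^{rev}$ is the reverse order of $\mathcal{L}$. When $\mathcal{L}_0,\mathcal{L}_1$ are computable, pairs are coded as natural numbers by a fixed computable bijection $\langle\cdot,\cdot\rangle:\omega^2\to\omega$, so that the sum and product are computable linear orders. In $\mathbb{N}+\mathbb{Q}\times\mathbb{Z}$ the product is taken before the sum. $\mathbb{N},\mathbb{Z},\mathbb{Q}$ denote the usual ordered sets of natural numbers, integers, and rationals. The successor function of a linear order isomorphic to $\mathbb{N}$ sends each element to its immediate successor in that order. -}

module Defs where

open import Level using (0ℓ)
open import Data.Empty using (⊥)
open import Data.Fin.Base using (Fin)
open import Data.Integer.Base using (ℤ)
import Data.Integer.Base as ℤ
open import Data.List.Base using (List)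
import Data.List.Membership.Propositional as List
open import Data.Nat.Base using (ℕ; zero; suc; _<_)
open import Data.Product.Base using (Σ; ∃; ∃₂; _×_; _,_; proj₁; proj₂)
open import Data.Product.Relation.Binary.Lex.Strict using (×-Lex)
import Data.Product.Relation.Binary.Pointwise.NonDependent as Product
open import Data.Rational.Base using (ℚ)
import Data.Rational.Base as ℚ
open import Data.Sum.Base using (_⊎_)
open import Data.Sum.Relation.Binary.LeftOrder using (_⊎-<_)
import Data.Sum.Relation.Binary.Pointwise as Sum
open import Data.Vec.Base using (Vec; []; _∷_; lookup)
open import Data.Vec.Relation.Binary.Pointwise.Inductive using (Pointwise)
open import Function.Base using (_on_; flip)
open import Function.Bundles using (_↔_; Inverse)
open import Relation.Binary.Bundles.Raw using (RawRelation)
open import Relation.Binary.Core using (Rel)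
open import Relation.Binary.Definitions using (Dense)
open import Relation.Binary.Morphism.Structures using (IsOrderIsomorphism)
open import Relation.Binary.PropositionalEquality.Core using (_≡_)
open import Relation.Binary.Structures using (IsStrictTotalOrder)
open import Relation.Nullary.Negation.Core using (¬_)
open import Relation.Unary using (Pred; _∈_; _⊆_; _∩_; _∖_; _≐_; ∁)

-- Partial computable functions are Kleene's μ-recursive functions.
data Rec : ℕ → Set where
  zero : ∀ {n} → Rec n
  succ : Rec 1
  proj : ∀ {n} → Fin n → Rec n
  comp : ∀ {m n} → Rec m → Vec (Rec n) m → Rec n
  prec : ∀ {n} → Rec n → Rec (suc (suc n)) → Rec (suc n)
  mu   : ∀ {n} → Rec (suc n) → Rec n

infix 4 _[_]⇓_

-- f [ xs ]⇓ y : the partial function coded by f is defined at xs, with value y.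
data _[_]⇓_ : ∀ {n} → Rec n → Vec ℕ n → ℕ → Set where
  ⇓zero  : ∀ {n} {xs : Vec ℕ n} → zero [ xs ]⇓ 0
  ⇓succ  : ∀ {x} → succ [ x ∷ [] ]⇓ suc x
  ⇓proj  : ∀ {n} {i : Fin n} {xs} → proj i [ xs ]⇓ lookup xs i
  ⇓comp  : ∀ {m n} {f : Rec m} {gs : Vec (Rec n) m} {xs ys z} →
           Pointwise (λ g y → g [ xs ]⇓ y) gs ys → f [ ys ]⇓ z →
           comp f gs [ xs ]⇓ z
  ⇓prec₀ : ∀ {n} {f : Rec n} {g xs y} →
           f [ xs ]⇓ y → prec f g [ 0 ∷ xs ]⇓ y
  ⇓precₛ : ∀ {n} {f : Rec n} {g xs k r y} →
           prec f g [ k ∷ xs ]⇓ r → g [ k ∷ r ∷ xs ]⇓ y →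
           prec f g [ suc k ∷ xs ]⇓ y
  ⇓mu    : ∀ {n} {f : Rec (suc n)} {xs y} →
           f [ y ∷ xs ]⇓ 0 →
           (∀ {z} → z < y → ∃ λ v → f [ z ∷ xs ]⇓ suc v) →
           mu f [ xs ]⇓ y

Dom : Rec 1 → Pred ℕ 0ℓ
Dom f x = ∃ λ y → f [ x ∷ [] ]⇓ y

Computable : ∀ {n} → Pred (Vec ℕ n) 0ℓ → Set
Computable {n} R = Σ (Rec n) λ c → ∀ xs →
  (R xs × c [ xs ]⇓ 1) ⊎ (¬ R xs × c [ xs ]⇓ 0)

CE : Pred ℕ 0ℓ → Set
CE W = ∃ λ e → W ≐ Dom e

record ComputablePairing : Set where
  field
    bijection : (ℕ × ℕ) ↔ ℕ
    code      : Rec 2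
    computes  : ∀ x y → code [ x ∷ y ∷ [] ]⇓ Inverse.to bijection (x , y)

  unpair : ℕ → ℕ × ℕ
  unpair = Inverse.from bijection

Finite : Pred ℕ 0ℓ → Set
Finite X = Σ (List ℕ) λ xs → X ⊆ (List._∈ xs)

infix 4 _⊆*_

_⊆*_ : Rel (Pred ℕ 0ℓ) 0ℓ
X ⊆* Y = Finite (X ∖ Y)

record Cohesive (C : Pred ℕ 0ℓ) : Set₁ where
  field
    infinite : ¬ Finite C
    cohesive : ∀ {W} → CE W → Finite (W ∩ C) ⊎ Finite (∁ W ∩ C)

-- Structures are taken modulo _≈_, which replaces forming quotients; _∼_
-- is the strict order.
Structure : Set₁
Structure = RawRelation 0ℓ 0ℓ 0ℓ

infix 4 _≅_

_≅_ : Rel Structure 0ℓ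
A ≅ B = ∃ λ f → IsOrderIsomorphism A._≈_ B._≈_ A._∼_ B._∼_ f
  where
  module A = RawRelation A
  module B = RawRelation B

infixr 6 _⊕_
infixr 7 _⊗_

_⊕_ : Structure → Structure → Structure
A ⊕ B = record
  { Carrier = A.Carrier ⊎ B.Carrier
  ; _≈_     = Sum.Pointwise A._≈_ B._≈_
  ; _∼_     = A._∼_ ⊎-< B._∼_
  }
  where
  module A = RawRelation A
  module B = RawRelation B

_⊗_ : Structure → Structure → Structure
A ⊗ B = record
  { Carrier = A.Carrier × B.Carrier
  ; _≈_     = Product.Pointwise A._≈_ B._≈_
  ; _∼_     = ×-Lex A._≈_ A._∼_ B._∼_
  }
  where
  module A = RawRelation A
  module B = RawRelation B

rev : Structure → Structure
rev A = record { Carrier = A.Carrier ; _≈_ = A._≈_ ; _∼_ = flip A._∼_ }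
  where module A = RawRelation A

ℕ< : Structure
ℕ< = record { Carrier = ℕ ; _≈_ = _≡_ ; _∼_ = _<_ }

ℤ< : Structure
ℤ< = record { Carrier = ℤ ; _≈_ = _≡_ ; _∼_ = ℤ._<_ }

ℚ< : Structure
ℚ< = record { Carrier = ℚ ; _≈_ = _≡_ ; _∼_ = ℚ._<_ }

NoEndpoints : Structure → Set
NoEndpoints A = ∀ x → (∃ λ y → y ∼ x) × (∃ λ z → x ∼ z)
  where open RawRelation A

ImmediateSuccessor : (A : Structure) → Rel (RawRelation.Carrier A) 0ℓ
ImmediateSuccessor A x y = x ∼ y × ∀ z → ¬ (x ∼ z × z ∼ y)
  where open RawRelation A

-- Only the restriction of lt to dom is meaningful.
record ωOrder : Set₁ where
  field
    dom : Pred ℕ 0ℓ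
    lt  : Rel ℕ 0ℓ

open ωOrder

⌊_⌋ : ωOrder → Structure
⌊ L ⌋ = record
  { Carrier = ∃ (dom L)
  ; _≈_     = _≡_ on proj₁
  ; _∼_     = lt L on proj₁
  }

record IsComputableLinearOrder (L : ωOrder) : Set where
  open RawRelation ⌊ L ⌋
  field
    nonempty           : Carrier
    isStrictTotalOrder : IsStrictTotalOrder _≈_ _∼_
    dom-computable     : Computable {1} λ { (x ∷ []) → x ∈ dom L }
    lt-computable      : Computable {2} λ { (x ∷ y ∷ []) →
                           x ∈ dom L × y ∈ dom L × lt L x y }

record ComputableLinearOrder : Set₁ where
  field
    order                   : ωOrder
    isComputableLinearOrder : IsComputableLinearOrder order

  open IsComputableLinearOrder isComputableLinearOrder public

DenseWithoutEndpoints : ωOrder → Set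
DenseWithoutEndpoints L = Dense (RawRelation._∼_ ⌊ L ⌋) × NoEndpoints ⌊ L ⌋

-- A computable order has a computable domain, so that the successor
-- function L → L is computable iff some partial computable function on ω
-- agrees with it on the domain.
ComputableSuccessor : ωOrder → Set
ComputableSuccessor L = Σ (Rec 1) λ s → ∀ (x : Carrier) → Σ Carrier λ y →
  s [ proj₁ x ∷ [] ]⇓ proj₁ y × ImmediateSuccessor ⌊ L ⌋ x y
  where open RawRelation ⌊ L ⌋

module Coded (pairing : ComputablePairing) where
  open ComputablePairing pairing using (unpair)

  infixr 6 _+ω_
  infixr 7 _×ω_

  _+ω_ : ωOrder → ωOrder → ωOrder
  L₀ +ω L₁ = record
    { dom = λ n → dom′ (unpair n)
    ; lt  = λ m n → lt′ (unpair m) (unpair n)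
    }
    where
    dom′ : Pred (ℕ × ℕ) 0ℓ
    dom′ (0 , l)           = l ∈ dom L₀
    dom′ (1 , l)           = l ∈ dom L₁
    dom′ (suc (suc _) , _) = ⊥

    -- The order of the summand with index i; irrelevant unless i ≤ 1.
    component : ℕ → Rel ℕ 0ℓ
    component zero    = lt L₀
    component (suc _) = lt L₁

    lt′ : Rel (ℕ × ℕ) 0ℓ
    lt′ (i , l) (j , m) = i < j ⊎ (i ≡ j × component i l m)

  _×ω_ : ωOrder → ωOrder → ωOrder
  L₀ ×ω L₁ = record
    { dom = λ n → dom′ (unpair n)
    ; lt  = λ m n → ×-Lex _≡_ (lt L₀) (lt L₁) (unpair m) (unpair n)
    }
    where
    dom′ : Pred (ℕ × ℕ) 0ℓ
    dom′ (k , m) = k ∈ dom L₀ × m ∈ dom L₁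

revω : ωOrder → ωOrder
revω L = record { dom = dom L ; lt = flip (lt L) }

record PartialElement (C : Pred ℕ 0ℓ) (L : ωOrder) : Set where
  field
    φ       : Rec 1
    range   : ∀ {x y} → φ [ x ∷ [] ]⇓ y → y ∈ dom L
    defined : C ⊆* Dom φ

open PartialElement

Π : Pred ℕ 0ℓ → ωOrder → Structure
Π C L = record
  { Carrier = PartialElement C L
  ; _≈_     = λ f g → C ⊆* λ x → ∃ λ y →
                φ f [ x ∷ [] ]⇓ y × φ g [ x ∷ [] ]⇓ y
  ; _∼_     = λ f g → C ⊆* λ x → ∃₂ λ y z →
                φ f [ x ∷ [] ]⇓ y × φ g [ x ∷ [] ]⇓ z × lt L y z
  }

{-# OPTIONS --safe #-}

-- By cohesiveness a computable property that is decidable along an element of a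
-- power holds, or fails, at almost all points of C.  Hence every power is a strict
-- total order, and a computable map between orders induces a map between powers.
-- Composition with pairing and the projections gives the sum and the product.
--
-- Powers are countable, since their elements are given by programs.  A computable
-- dense order without endpoints has a power of the same kind, because points in
-- between, above and below can be searched for; Cantor's theorem then applies.
--
-- A computable presentation of ℕ with computable successor is computably isomorphic
-- to ℕ.  In the power of ℕ an element is almost everywhere constant or dominates
-- all constants.  The elements of the second kind fall into blocks of elements at
-- finite distance, each a copy of ℤ.  The blocks are dense (between f and g lies
-- (f + g) / 2) and have no endpoints (f / 2 lies below f, and 2 f above), so they
-- form a copy of ℚ by Cantor's theorem.
module Submission where

open import Defs
open import Axiom.ExcludedMiddle using (ExcludedMiddle)
open import Data.Empty using (⊥; ⊥-elim)
open import Data.Fin.Base using (Fin; zero; suc; toℕ)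
open import Data.Fin.Properties using (toℕ-injective)
open import Data.Integer.Base as ℤ using (ℤ; +_; -[1+_])
import Data.Integer.Properties as ℤₚ
import Data.List.Base as List
open import Data.List.Membership.Propositional.Properties using (∈-++⁺ˡ; ∈-++⁺ʳ; ∈-upTo⁺)
open import Data.Nat.Base using (ℕ; zero; suc; _+_; _∸_; _≤_; _<_; z≤n; s≤s; _≤′_; ≤′-refl;
  ≤′-step; pred)
import Data.Nat.Properties as ℕₚ
open import Data.Nat.Solver using (module +-*-Solver)
open import Data.Product.Base using (Σ; ∃; ∃₂; _×_; _,_; proj₁; proj₂)
open import Data.Product.Relation.Binary.Lex.Strict using (×-isStrictTotalOrder; ×-Lex)
open import Data.Rational.Base as ℚ using (ℚ; mkℚ)
import Data.Rational.Properties as ℚₚ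
open import Data.Sum.Base using (_⊎_; inj₁; inj₂; [_,_]′)
open import Data.Sum.Relation.Binary.LeftOrder using (₁∼₂; ₁∼₁; ₂∼₂; ⊎-<-isStrictTotalOrder; _⊎-<_)
import Data.Sum.Relation.Binary.Pointwise as Sum
open import Data.Unit.Base using (⊤; tt)
open import Data.Vec.Base using (Vec; []; _∷_; lookup; head)
open import Data.Vec.Relation.Binary.Pointwise.Inductive using (Pointwise; []; _∷_)
open import Function.Base using (_on_)
open import Function.Bundles using (Inverse)
open import Level using (0ℓ)
open import Relation.Binary.Bundles.Raw using (RawRelation)
import Relation.Binary.Construct.Add.Extrema.Strict as Extrema
import Relation.Binary.Construct.On as On
open import Relation.Binary.Definitions using (Dense; tri<; tri≈; tri>; Tri)
import Relation.Binary.Morphism.Construct.Composition as Composition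
open import Relation.Binary.Morphism.Structures using (IsOrderIsomorphism)
open import Relation.Binary.PropositionalEquality as ≡ using (_≡_; refl; sym; cong; cong₂;
  subst; subst₂)
open import Relation.Binary.Structures using (IsStrictTotalOrder; IsStrictPartialOrder)
open import Relation.Binary.Structures.Biased using (isStrictTotalOrderᶜ)
open import Relation.Nullary using (¬_; yes; no)
open import Relation.Nullary.Construct.Add.Extrema using (_±; ⊥±; ⊤±; [_])
open import Relation.Nullary.Decidable using (decidable-stable)
open import Relation.Unary using (Pred; _∈_)
open ωOrder using (dom; lt)
open PartialElement using (φ; range; defined)
open ComputableLinearOrder using (order)

-- Cantor's theorem

-- Monotone surjections become isomorphisms once the source is a strict total order; the target may
-- be a partial one. So the maps for sums, products and `ℕ` are built towards the power (from the
-- sum of the powers to the power of the sum, say) and inverted afterwards: trichotomy is never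
-- argued for the coded sum or product, and no inverse has to be checked for monotonicity by hand.
-- The pairing is an arbitrary computable bijection, and its inverse is not given by a program.
-- Minimisation looks for one number at a time, so two coordinates cannot be searched for at once.
-- An inner search, total for every guess of `x + y`, and an outer search for the right guess
-- recover the projections. Excluded middle is used where finite sets of exceptions are told apart,
-- where partial elements are made total, where the infinite and the finite distance are separated,
-- and where it is asked whether a number codes an element.

∣_∣ : Structure → Set
∣_∣ = RawRelation.Carrier

IsSTO : Structure → Set
IsSTO A = IsStrictTotalOrder (RawRelation._≈_ A) (RawRelation._∼_ A)

IsSPO : Structure → Set
IsSPO A = IsStrictPartialOrder (RawRelation._≈_ A) (RawRelation._∼_ A)

module _ {A B : Structure} (isSTO-A : IsSTO A) (isSPO-B : IsSPO B) where
  private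
    module A = RawRelation A
    module B = RawRelation B
    module SA = IsStrictTotalOrder isSTO-A
    module SB = IsStrictPartialOrder isSPO-B

  -- Injectivity and cancellation come from trichotomy in `A`: each wrong case is pushed forward by
  -- `f` and contradicts irreflexivity or asymmetry in `B`.
  ≅-intro : (f : ∣ A ∣ → ∣ B ∣) →
    (∀ {x y} → x A.≈ y → f x B.≈ f y) →
    (∀ {x y} → x A.∼ y → f x B.∼ f y) →
    (∀ y → ∃ λ x → f x B.≈ y) → A ≅ B
  ≅-intro f cong mono onto = f , record
    { isOrderMonomorphism = record
      { isOrderHomomorphism = record { cong = cong ; mono = mono }
      ; injective = injective
      ; cancel = cancel
      }
    ; surjective = λ y → proj₁ (onto y) ,
        λ z≈x → SB.Eq.trans (cong z≈x) (proj₂ (onto y))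
    }
    where
    injective : ∀ {x y} → f x B.≈ f y → x A.≈ y
    injective {x} {y} fx≈fy with SA.compare x y
    ... | tri< x<y _ _ = ⊥-elim (SB.irrefl fx≈fy (mono x<y))
    ... | tri≈ _ x≈y _ = x≈y
    ... | tri> _ _ y<x = ⊥-elim (SB.irrefl (SB.Eq.sym fx≈fy) (mono y<x))

    cancel : ∀ {x y} → f x B.∼ f y → x A.∼ y
    cancel {x} {y} fx<fy with SA.compare x y
    ... | tri< x<y _ _ = x<y
    ... | tri≈ _ x≈y _ = ⊥-elim (SB.irrefl (cong x≈y) fx<fy)
    ... | tri> _ _ y<x = ⊥-elim (SB.asym fx<fy (mono y<x))

  ≅-sym : A ≅ B → B ≅ A
  ≅-sym (f , isIso) = g , record
    { isOrderMonomorphism = record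
      { isOrderHomomorphism = record
        { cong = λ {x} {y} x≈y → I.injective
            (SB.Eq.trans (f∘g x) (SB.Eq.trans x≈y (SB.Eq.sym (f∘g y))))
        ; mono = λ {x} {y} x<y → I.cancel
            (SB.<-respʳ-≈ (SB.Eq.sym (f∘g y)) (SB.<-respˡ-≈ (SB.Eq.sym (f∘g x)) x<y))
        }
      ; injective = λ {x} {y} gx≈gy →
          SB.Eq.trans (SB.Eq.sym (f∘g x)) (SB.Eq.trans (I.cong gx≈gy) (f∘g y))
      ; cancel = λ {x} {y} gx<gy →
          SB.<-respʳ-≈ (f∘g y) (SB.<-respˡ-≈ (f∘g x) (I.mono gx<gy))
      }
    ; surjective = λ x → f x , λ z≈fx → I.injective (SB.Eq.trans (f∘g _) z≈fx)
    }
    where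
    module I = IsOrderIsomorphism isIso
    g : ∣ B ∣ → ∣ A ∣
    g y = proj₁ (I.surjective y)
    f∘g : ∀ y → f (g y) B.≈ y
    f∘g y = proj₂ (I.surjective y) SA.Eq.refl

record IsCountableDense (A : Structure) : Set where
  open RawRelation A
  field
    isStrictTotalOrder : IsSTO A
    dense              : Dense _∼_
    noEndpoints        : NoEndpoints A
    point              : Carrier
    code               : Carrier → ℕ
    code-injective     : ∀ {x y} → code x ≡ code y → x ≈ y

  open IsStrictTotalOrder isStrictTotalOrder public
  open Extrema _∼_ public using (_<±_; ⊥±<[_]; ⊥±<⊤±; [_]<⊤±)

  -- The added extrema stand for missing bounds. The four shapes of a gap call on inhabitedness, the
  -- lack of a least element, the lack of a greatest element, and density.
  between : ∀ {l r} → l <± r → Σ Carrier λ x → l <± [ x ] × [ x ] <± r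
  between ⊥±<⊤±              = point , ⊥±<[ _ ] , [ _ ]<⊤±
  between (⊥±<[ r ])         = proj₁ (proj₁ (noEndpoints r)) , ⊥±<[ _ ] ,
                               Extrema.[ proj₂ (proj₁ (noEndpoints r)) ]
  between ([ l ]<⊤±)         = proj₁ (proj₂ (noEndpoints l)) ,
                               Extrema.[ proj₂ (proj₂ (noEndpoints l)) ] , [ _ ]<⊤±
  between (Extrema.[ l<r ])  with dense l<r
  ... | x , l<x , x<r = x , Extrema.[ l<x ] , Extrema.[ x<r ]

  <±-trans : ∀ {x y z} → x <± y → y <± z → x <± z
  <±-trans = Extrema.<±-trans _∼_ trans

  <±-resp : ∀ {l r x y} → x ≈ y → l <± [ y ] × [ y ] <± r → l <± [ x ] × [ x ] <± r
  <±-resp {l} {r} {x} {y} x≈y (l<y , y<r) = lower l<y , upper y<r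
    where
    lower : ∀ {l} → l <± [ y ] → l <± [ x ]
    lower (⊥±<[ _ ])        = ⊥±<[ _ ]
    lower (Extrema.[ l<y ]) = Extrema.[ <-respʳ-≈ (Eq.sym x≈y) l<y ]
    upper : ∀ {r} → [ y ] <± r → [ x ] <± r
    upper ([ _ ]<⊤±)        = [ _ ]<⊤±
    upper (Extrema.[ y<r ]) = Extrema.[ <-respˡ-≈ (Eq.sym x≈y) y<r ]

-- A finite partial isomorphism is stored as a search tree whose nodes are
-- pairs of matched elements and whose leaves are pairs of matched gaps.
module BackAndForth {A B : Structure}
  (cd-A : IsCountableDense A) (cd-B : IsCountableDense B) where
  private
    module A where
      open RawRelation A public
      open IsCountableDense cd-A public
    module B where
      open RawRelation B public
      open IsCountableDense cd-B public

  data Tree (l r : ∣ A ∣ ±) (l′ r′ : ∣ B ∣ ±) : Set where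
    leaf : l A.<± r → l′ B.<± r′ → Tree l r l′ r′
    node : ∀ a b → Tree l [ a ] l′ [ b ] → Tree [ a ] r [ b ] r′ → Tree l r l′ r′

  data Matched (x : ∣ A ∣) (y : ∣ B ∣) {l r l′ r′} : Tree l r l′ r′ → Set where
    here  : ∀ {a b s t} → x A.≈ a → y B.≈ b → Matched x y (node a b s t)
    left  : ∀ {a b s t} → Matched x y s → Matched x y (node a b s t)
    right : ∀ {a b s t} → Matched x y t → Matched x y (node a b s t)

  -- Nodes store no inequalities; those at the leaves are chained through the node elements.
  gap : ∀ {l r l′ r′} → Tree l r l′ r′ → l A.<± r × l′ B.<± r′
  gap (leaf p q) = p , q
  gap (node a b s t) with gap s | gap t
  ... | l<a , l′<b | a<r , b<r′ = A.<±-trans l<a a<r , B.<±-trans l′<b b<r′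

  bounded : ∀ {x y l r l′ r′} {t : Tree l r l′ r′} → Matched x y t →
    (l A.<± [ x ] × [ x ] A.<± r) × (l′ B.<± [ y ] × [ y ] B.<± r′)
  bounded (here {s = s} {t} x≈a y≈b) with gap s | gap t
  ... | l<a , l′<b | a<r , b<r′ = A.<±-resp x≈a (l<a , a<r) , B.<±-resp y≈b (l′<b , b<r′)
  bounded (left {t = t} m) with bounded m | gap t
  ... | (l<x , x<a) , (l′<y , y<b) | a<r , b<r′ =
    (l<x , A.<±-trans x<a a<r) , (l′<y , B.<±-trans y<b b<r′)
  bounded (right {s = s} m) with bounded m | gap s
  ... | (a<x , x<r) , (b<y , y<r′) | l<a , l′<b =
    (A.<±-trans l<a a<x , x<r) , (B.<±-trans l′<b b<y , y<r′)

  data Compatible (x x′ : ∣ A ∣) (y y′ : ∣ B ∣) : Set where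
    below : x A.∼ x′ → y B.∼ y′ → Compatible x x′ y y′
    equal : x A.≈ x′ → y B.≈ y′ → Compatible x x′ y y′
    above : x′ A.∼ x → y′ B.∼ y → Compatible x x′ y y′

  -- Two pairs sit at the same node or are separated by some node `a`, `b`. In the second case
  -- `bounded` puts them on opposite sides of `a` in `A` and of `b` in `B`, with the same
  -- orientation.
  matched-compatible : ∀ {x x′ y y′ l r l′ r′} {t : Tree l r l′ r′} →
    Matched x y t → Matched x′ y′ t → Compatible x x′ y y′
  matched-compatible (here p q) (here p′ q′) =
    equal (A.Eq.trans p (A.Eq.sym p′)) (B.Eq.trans q (B.Eq.sym q′))
  matched-compatible (here p q) (left m) with bounded m
  ... | (_ , Extrema.[ u ]) , (_ , Extrema.[ v ]) =
    above (A.<-respʳ-≈ (A.Eq.sym p) u) (B.<-respʳ-≈ (B.Eq.sym q) v)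
  matched-compatible (here p q) (right m) with bounded m
  ... | (Extrema.[ u ] , _) , (Extrema.[ v ] , _) =
    below (A.<-respˡ-≈ (A.Eq.sym p) u) (B.<-respˡ-≈ (B.Eq.sym q) v)
  matched-compatible (left m) (here p q) with bounded m
  ... | (_ , Extrema.[ u ]) , (_ , Extrema.[ v ]) =
    below (A.<-respʳ-≈ (A.Eq.sym p) u) (B.<-respʳ-≈ (B.Eq.sym q) v)
  matched-compatible (left m) (left m′) = matched-compatible m m′
  matched-compatible (left m) (right m′) with bounded m | bounded m′
  ... | (_ , Extrema.[ u ]) , (_ , Extrema.[ v ])
      | (Extrema.[ u′ ] , _) , (Extrema.[ v′ ] , _) = below (A.trans u u′) (B.trans v v′)
  matched-compatible (right m) (here p q) with bounded m
  ... | (Extrema.[ u ] , _) , (Extrema.[ v ] , _) =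
    above (A.<-respˡ-≈ (A.Eq.sym p) u) (B.<-respˡ-≈ (B.Eq.sym q) v)
  matched-compatible (right m) (left m′) with bounded m | bounded m′
  ... | (Extrema.[ u ] , _) , (Extrema.[ v ] , _)
      | (_ , Extrema.[ u′ ]) , (_ , Extrema.[ v′ ]) = above (A.trans u′ u) (B.trans v′ v)
  matched-compatible (right m) (right m′) = matched-compatible m m′

  Extends : ∀ {l r l′ r′} → Tree l r l′ r′ → Tree l r l′ r′ → Set
  Extends s t = ∀ {x y} → Matched x y s → Matched x y t

  -- Descent by comparison with the node elements of `A` ends at an element equal to `a` or at a
  -- leaf. The gap of `B` stored in that leaf is where the partner is chosen.
  insert : ∀ {l r l′ r′} (t : Tree l r l′ r′) a → l A.<± [ a ] → [ a ] A.<± r →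
    Σ (Tree l r l′ r′) λ t′ → Extends t t′ × ∃ λ b → Matched a b t′
  insert (leaf _ q) a l<a a<r with B.between q
  ... | b , l′<b , b<r′ =
    node a b (leaf l<a l′<b) (leaf a<r b<r′) , (λ ()) , b , here A.Eq.refl B.Eq.refl
  insert (node c d s t) a l<a a<r with A.compare a c
  ... | tri< a<c _ _ with insert s a l<a Extrema.[ a<c ]
  ...   | s′ , ext , b , m = node c d s′ t ,
          (λ { (here p q) → here p q ; (left n) → left (ext n) ; (right n) → right n }) ,
          b , left m
  insert (node c d s t) a l<a a<r | tri≈ _ a≈c _ =
    node c d s t , (λ m → m) , d , here a≈c B.Eq.refl
  insert (node c d s t) a l<a a<r | tri> _ _ c<a with insert t a Extrema.[ c<a ] a<r
  ...   | t′ , ext , b , m = node c d s t′ ,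
          (λ { (here p q) → here p q ; (left n) → left n ; (right n) → right (ext n) }) ,
          b , right m

  Full : Set
  Full = Tree ⊥± ⊤± ⊥± ⊤±

  Covers : ℕ → Full → Set
  Covers n t = ∀ x → A.code x ≡ n → ∃ λ y → Matched x y t

  -- Codes need not exhaust the natural numbers, so excluded middle tells whether `n` is one. All
  -- elements with code `n` are equal modulo `≈`, so one insertion serves them all.
  forth : ExcludedMiddle 0ℓ → ∀ n t → Σ Full λ t′ → Extends t t′ × Covers n t′
  forth em n t with em {∃ λ x → A.code x ≡ n}
  ... | no none = t , (λ m → m) , λ x e → ⊥-elim (none (x , e))
  ... | yes (a , e) with insert t a A.⊥±<[ a ] A.[ a ]<⊤±
  ...   | t′ , ext , b , m = t′ , ext , λ x e′ → b , resp (A.code-injective (≡.trans e′ (sym e))) m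
    where
    resp : ∀ {x a b l r l′ r′} {t : Tree l r l′ r′} → x A.≈ a → Matched a b t → Matched x b t
    resp x≈a (here p q) = here (A.Eq.trans x≈a p) q
    resp x≈a (left m)   = left (resp x≈a m)
    resp x≈a (right m)  = right (resp x≈a m)

module _ {A B : Structure} (cd-A : IsCountableDense A) (cd-B : IsCountableDense B) where
  private
    module F = BackAndForth cd-A cd-B
    module G = BackAndForth cd-B cd-A

  -- The back step is the forth step on the mirrored tree.
  flip-tree : ∀ {l r l′ r′} → F.Tree l r l′ r′ → G.Tree l′ r′ l r
  flip-tree (F.leaf p q)     = G.leaf q p
  flip-tree (F.node a b s t) = G.node b a (flip-tree s) (flip-tree t)

  flip-matched : ∀ {x y l r l′ r′} {t : F.Tree l r l′ r′} →
    F.Matched x y t → G.Matched y x (flip-tree t)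
  flip-matched (F.here p q) = G.here q p
  flip-matched (F.left m)   = G.left (flip-matched m)
  flip-matched (F.right m)  = G.right (flip-matched m)

module _ (em : ExcludedMiddle 0ℓ) {A B : Structure}
  (cd-A : IsCountableDense A) (cd-B : IsCountableDense B) where
  private
    module A where
      open RawRelation A public
      open IsCountableDense cd-A public
    module B where
      open RawRelation B public
      open IsCountableDense cd-B public
    module G = BackAndForth cd-B cd-A
    open BackAndForth cd-A cd-B

    step : ∀ n t → Σ Full λ t′ → Extends t t′ × Covers n t′ ×
      (∀ y → B.code y ≡ n → ∃ λ x → Matched x y t′)
    step n t with forth em n t
    ... | t₁ , ext₁ , covers with G.forth em n (flip-tree cd-A cd-B t₁)
    ...   | t₂ , ext₂ , covers′ = flip-tree cd-B cd-A t₂ ,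
            (λ m → ext (ext₁ m)) ,
            (λ x e → proj₁ (covers x e) , ext (proj₂ (covers x e))) ,
            (λ y e → proj₁ (covers′ y e) , flip-matched cd-B cd-A (proj₂ (covers′ y e)))
      where
      ext : Extends t₁ (flip-tree cd-B cd-A t₂)
      ext m = flip-matched cd-B cd-A (ext₂ (flip-matched cd-A cd-B m))

    stage : ℕ → Full
    stage zero    = leaf A.⊥±<⊤± B.⊥±<⊤±
    stage (suc n) = proj₁ (step n (stage n))

    stage-extends : ∀ {m n} → m ≤′ n → Extends (stage m) (stage n)
    stage-extends ≤′-refl       p = p
    stage-extends {n = suc n} (≤′-step m≤n) p =
      proj₁ (proj₂ (step n (stage n))) (stage-extends m≤n p)

    Paired : ∣ A ∣ → ∣ B ∣ → Set
    Paired x y = ∃ λ n → Matched x y (stage n)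

    -- Stages only grow, so both pairs occur together in stage `m ⊔ n`.
    paired-compatible : ∀ {x x′ y y′} → Paired x y → Paired x′ y′ → Compatible x x′ y y′
    paired-compatible (m , p) (n , q) = matched-compatible
      (stage-extends (ℕₚ.≤⇒≤′ (ℕₚ.m≤m⊔n m n)) p) (stage-extends (ℕₚ.≤⇒≤′ (ℕₚ.m≤n⊔m m n)) q)

    image : ∀ x → ∃ λ y → Paired x y
    image x with proj₁ (proj₂ (proj₂ (step (A.code x) (stage (A.code x))))) x refl
    ... | y , m = y , suc (A.code x) , m

    preimage : ∀ y → ∃ λ x → Paired x y
    preimage y with proj₂ (proj₂ (proj₂ (step (B.code y) (stage (B.code y))))) y refl
    ... | x , m = x , suc (B.code y) , m

  abstract
    cantor : A ≅ B
    cantor = ≅-intro A.isStrictTotalOrder B.isStrictPartialOrder (λ x → proj₁ (image x))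
      (λ {x} {x′} → cong′ (proj₂ (image x)) (proj₂ (image x′)))
      (λ {x} {x′} → mono (proj₂ (image x)) (proj₂ (image x′)))
      -- The preimage of `y` is paired with `y` and also with its own image; compatibility
      -- identifies the two.
      (λ y → proj₁ (preimage y) , cong′ (proj₂ (image _)) (proj₂ (preimage y)) A.Eq.refl)
      where
      cong′ : ∀ {x x′ y y′} → Paired x y → Paired x′ y′ → x A.≈ x′ → y B.≈ y′
      cong′ p q x≈x′ with paired-compatible p q
      ... | below x<x′ _ = ⊥-elim (A.irrefl x≈x′ x<x′)
      ... | equal _ y≈y′ = y≈y′
      ... | above x′<x _ = ⊥-elim (A.irrefl (A.Eq.sym x≈x′) x′<x)

      mono : ∀ {x x′ y y′} → Paired x y → Paired x′ y′ → x A.∼ x′ → y B.∼ y′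
      mono p q x<x′ with paired-compatible p q
      ... | below _ y<y′ = y<y′
      ... | equal x≈x′ _ = ⊥-elim (A.irrefl x≈x′ x<x′)
      ... | above x′<x _ = ⊥-elim (A.asym x<x′ x′<x)

-- Recursive functions

mutual
  deterministic : ∀ {n} (f : Rec n) {xs y z} → f [ xs ]⇓ y → f [ xs ]⇓ z → y ≡ z
  deterministic _ ⇓zero ⇓zero = refl
  deterministic _ ⇓succ ⇓succ = refl
  deterministic _ ⇓proj ⇓proj = refl
  deterministic (comp f gs) (⇓comp ps p) (⇓comp qs q) with deterministic* gs ps qs
  ... | refl = deterministic f p q
  deterministic (prec f g) (⇓prec₀ p) (⇓prec₀ q) = deterministic f p q
  deterministic (prec f g) (⇓precₛ p p′) (⇓precₛ q q′) with deterministic (prec f g) p q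
  ... | refl = deterministic g p′ q′
  deterministic (mu f) {y = y} {z} (⇓mu p h) (⇓mu q k) with ℕₚ.<-cmp y z
  ... | tri≈ _ y≡z _ = y≡z
  ... | tri< y<z _ _ with deterministic f p (proj₂ (k y<z))
  ...   | ()
  deterministic (mu f) (⇓mu p h) (⇓mu q k) | tri> _ _ z<y with deterministic f q (proj₂ (h z<y))
  ...   | ()

  deterministic* : ∀ {m n} (gs : Vec (Rec n) m) {xs} {ys zs : Vec ℕ m} →
    Pointwise (λ g y → g [ xs ]⇓ y) gs ys → Pointwise (λ g z → g [ xs ]⇓ z) gs zs → ys ≡ zs
  deterministic* []       []       []       = refl
  deterministic* (g ∷ gs) (p ∷ ps) (q ∷ qs) =
    cong₂ _∷_ (deterministic g p q) (deterministic* gs ps qs)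

Recursive : ∀ {n} → (Vec ℕ n → ℕ) → Set
Recursive F = ∃ λ f → ∀ xs → f [ xs ]⇓ F xs

recursive-resp : ∀ {n} {F G : Vec ℕ n → ℕ} → Recursive F → (∀ xs → F xs ≡ G xs) → Recursive G
recursive-resp (f , f⇓) F≗G = f , λ xs → subst (f [ xs ]⇓_) (F≗G xs) (f⇓ xs)

Computes₂ : Rec 2 → (ℕ → ℕ → ℕ) → Set
Computes₂ f F = ∀ x y → f [ x ∷ y ∷ [] ]⇓ F x y

lift₁ : ∀ {f : Rec 1} (F : ℕ → ℕ) {n} {G : Vec ℕ n → ℕ} → (∀ x → f [ x ∷ [] ]⇓ F x) →
  Recursive G → Recursive (λ xs → F (G xs))
lift₁ {f} F f⇓ (g , g⇓) = comp f (g ∷ []) , λ xs → ⇓comp (g⇓ xs ∷ []) (f⇓ _)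

lift₂ : ∀ {f : Rec 2} {F n} {G H : Vec ℕ n → ℕ} → Computes₂ f F →
  Recursive G → Recursive H → Recursive (λ xs → F (G xs) (H xs))
lift₂ {f} f⇓ (g , g⇓) (h , h⇓) =
  comp f (g ∷ h ∷ []) , λ xs → ⇓comp (g⇓ xs ∷ h⇓ xs ∷ []) (f⇓ _ _)

var : ∀ {n} (i : Fin n) → Recursive (λ xs → lookup xs i)
var i = proj i , λ _ → ⇓proj

constant : ∀ {n} k → Recursive {n} (λ _ → k)
constant zero    = zero , λ _ → ⇓zero
constant (suc k) = lift₁ suc (λ _ → ⇓succ) (constant k)

pred-rec : Rec 1
pred-rec = prec zero (proj zero)

pred-⇓ : ∀ x → pred-rec [ x ∷ [] ]⇓ pred x
pred-⇓ zero    = ⇓prec₀ ⇓zero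
pred-⇓ (suc x) = ⇓precₛ (pred-⇓ x) ⇓proj

add-rec : Rec 2
add-rec = prec (proj zero) (comp succ (proj (suc zero) ∷ []))

add-⇓ : Computes₂ add-rec _+_
add-⇓ zero    y = ⇓prec₀ ⇓proj
add-⇓ (suc x) y = ⇓precₛ (add-⇓ x y) (⇓comp (⇓proj ∷ []) ⇓succ)

sub-rec : Rec 2
sub-rec = prec (proj zero) (comp pred-rec (proj (suc zero) ∷ []))

-- Primitive recursion runs on the first argument, so the subtrahend comes first; `_⟨∸⟩_` restores
-- the usual order.
sub-⇓ : Computes₂ sub-rec (λ x y → y ∸ x)
sub-⇓ zero    y = ⇓prec₀ ⇓proj
sub-⇓ (suc x) y = ⇓precₛ (sub-⇓ x y) (⇓comp (⇓proj ∷ [])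
  (subst (pred-rec [ y ∸ x ∷ [] ]⇓_) (ℕₚ.pred[m∸n]≡m∸[1+n] y x) (pred-⇓ _)))

infixl 6 _⟨+⟩_ _⟨∸⟩_

_⟨+⟩_ : ∀ {n} {F G : Vec ℕ n → ℕ} → Recursive F → Recursive G → Recursive (λ xs → F xs + G xs)
_⟨+⟩_ = lift₂ add-⇓

_⟨∸⟩_ : ∀ {n} {F G : Vec ℕ n → ℕ} → Recursive F → Recursive G → Recursive (λ xs → F xs ∸ G xs)
f ⟨∸⟩ g = lift₂ sub-⇓ g f

dist : ℕ → ℕ → ℕ
dist x y = (x ∸ y) + (y ∸ x)

dist-refl : ∀ x → dist x x ≡ 0
dist-refl x = cong₂ _+_ (ℕₚ.n∸n≡0 x) (ℕₚ.n∸n≡0 x)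

dist≡0⇒≡ : ∀ x y → dist x y ≡ 0 → x ≡ y
dist≡0⇒≡ x y e = ℕₚ.≤-antisym (ℕₚ.m∸n≡0⇒m≤n (ℕₚ.m+n≡0⇒m≡0 (x ∸ y) e))
                               (ℕₚ.m∸n≡0⇒m≤n (ℕₚ.m+n≡0⇒n≡0 (x ∸ y) e))

⟨dist⟩ : ∀ {n} {F G : Vec ℕ n → ℕ} → Recursive F → Recursive G → Recursive (λ xs → dist (F xs) (G xs))
⟨dist⟩ f g = (f ⟨∸⟩ g) ⟨+⟩ (g ⟨∸⟩ f)

ifZero : ℕ → ℕ → ℕ → ℕ
ifZero zero    x y = x
ifZero (suc _) x y = y

-- Composition is strict: both branches are computed although one is discarded, so both have to be
-- total.
⟨ifZero⟩ : ∀ {n} {F G H : Vec ℕ n → ℕ} → Recursive F → Recursive G → Recursive H →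
  Recursive (λ xs → ifZero (F xs) (G xs) (H xs))
⟨ifZero⟩ (f , f⇓) (g , g⇓) (h , h⇓) =
  comp ifZero-rec (f ∷ g ∷ h ∷ []) , λ xs → ⇓comp (f⇓ xs ∷ g⇓ xs ∷ h⇓ xs ∷ []) (ifZero-⇓ _ _ _)
  where
  ifZero-rec : Rec 3
  -- The step function receives `k ∷ r ∷ x ∷ y ∷ []`, so index 3 is `y`, whatever the previous value
  -- `r` was.
  ifZero-rec = prec (proj zero) (proj (suc (suc (suc zero))))
  ifZero-⇓ : ∀ k x y → ifZero-rec [ k ∷ x ∷ y ∷ [] ]⇓ ifZero k x y
  ifZero-⇓ zero    x y = ⇓prec₀ ⇓proj
  ifZero-⇓ (suc k) x y = ⇓precₛ (ifZero-⇓ k x y) ⇓proj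

LeastZero : (ℕ → ℕ) → ℕ → Set
LeastZero F y = F y ≡ 0 × (∀ {z} → z < y → ∃ λ v → F z ≡ suc v)

least-zero : ∀ (F : ℕ → ℕ) w → F w ≡ 0 → ∃ (LeastZero F)
least-zero F w e with F 0 in F0
... | zero  = 0 , F0 , λ ()
least-zero F zero e    | suc v with ≡.trans (sym e) F0
... | ()
least-zero F (suc w) e | suc v with least-zero (λ x → F (suc x)) w e
... | y , Fy , below = suc y , Fy , λ { {zero} _ → v , F0 ; {suc z} (s≤s z<y) → below z<y }

least-≤ : ∀ {F : ℕ → ℕ} {y w} → LeastZero F y → F w ≡ 0 → y ≤ w
least-≤ {y = y} {w} (_ , below) e = ℕₚ.≮⇒≥ λ w<y → absurd (below w<y)
  where
  absurd : ∃ (λ v → _ ≡ suc v) → ⊥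
  absurd (v , e′) with ≡.trans (sym e) e′
  ... | ()

mu-⇓ : ∀ {n} {G : Vec ℕ (suc n) → ℕ} (g : Recursive G) {xs y} →
  LeastZero (λ z → G (z ∷ xs)) y → mu (proj₁ g) [ xs ]⇓ y
mu-⇓ (g , g⇓) {xs} (e , below) =
  ⇓mu (subst (g [ _ ]⇓_) e (g⇓ _)) λ z<y →
    proj₁ (below z<y) , subst (g [ _ ]⇓_) (proj₂ (below z<y)) (g⇓ _)

⟨mu⟩ : ∀ {n} {G : Vec ℕ (suc n) → ℕ} → Recursive G → (∀ xs → ∃ λ y → G (y ∷ xs) ≡ 0) →
  ∃ λ F → Recursive F × (∀ xs → LeastZero (λ y → G (y ∷ xs)) (F xs))
⟨mu⟩ {G = G} g zeros = (λ xs → proj₁ (least xs)) ,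
  (mu (proj₁ g) , λ xs → mu-⇓ g (proj₂ (least xs))) , λ xs → proj₂ (least xs)
  where
  least : ∀ xs → ∃ (LeastZero (λ y → G (y ∷ xs)))
  least xs = least-zero _ (proj₁ (zeros xs)) (proj₂ (zeros xs))

-- Computable projections and a numbering of programs

module Pairing (pairing : ComputablePairing) where
  open ComputablePairing pairing renaming (code to pair-rec; computes to pair-⇓) public
  open Inverse bijection using (strictlyInverseˡ; strictlyInverseʳ)

  pair : ℕ → ℕ → ℕ
  pair x y = Inverse.to bijection (x , y)

  fst snd : ℕ → ℕ
  fst n = proj₁ (unpair n)
  snd n = proj₂ (unpair n)

  unpair-pair : ∀ x y → unpair (pair x y) ≡ (x , y)
  unpair-pair x y = strictlyInverseʳ (x , y)

  pair-unpair : ∀ n → pair (fst n) (snd n) ≡ n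
  pair-unpair n = strictlyInverseˡ n

  pair-injective : ∀ {x y x′ y′} → pair x y ≡ pair x′ y′ → x ≡ x′ × y ≡ y′
  pair-injective {x} {y} {x′} {y′} e with
    ≡.trans (sym (unpair-pair x y)) (≡.trans (cong unpair e) (unpair-pair x′ y′))
  ... | refl = refl , refl

  private
    -- The least x such that pair x (b ∸ x) ≡ n, or b if there is none below b.
    split = ⟨mu⟩ {n = 2} (⟨ifZero⟩
      (⟨dist⟩ (lift₂ pair-⇓ (var zero) (var (suc zero) ⟨∸⟩ var zero)) (var (suc (suc zero))))
      (constant 0) (var (suc zero) ⟨∸⟩ var zero))
      λ { (b ∷ n ∷ []) → b , ifZero-0 (dist (pair b (b ∸ b)) n) (ℕₚ.n∸n≡0 b) }
      where
      ifZero-0 : ∀ k {x} → x ≡ 0 → ifZero k 0 x ≡ 0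
      ifZero-0 zero    _ = refl
      ifZero-0 (suc _) e = e

    x-of : ℕ → ℕ → ℕ
    x-of b n = proj₁ split (b ∷ n ∷ [])

    -- The number `x` is itself a zero, so the least zero `r` is at most `x`. Either `r` passes the
    -- equality test, or it was accepted because `b ∸ r` is 0; then `x ≤ b ≤ r` forces `r ≡ x`.
    split-correct : ∀ x y → pair (x-of (x + y) (pair x y)) (x + y ∸ x-of (x + y) (pair x y)) ≡ pair x y
    split-correct x y = cases refl
      where
      n b r : ℕ
      n = pair x y
      b = x + y
      r = x-of b n
      D : ℕ → ℕ
      D z = dist (pair z (b ∸ z)) n
      least : LeastZero (λ z → ifZero (D z) 0 (b ∸ z)) r
      least = proj₂ (proj₂ split) (b ∷ n ∷ [])
      Dx : D x ≡ 0
      Dx = ≡.trans (cong (λ z → dist (pair x z) n) (ℕₚ.m+n∸m≡n x y)) (dist-refl n)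
      r≤x : r ≤ x
      r≤x = least-≤ least (cong (λ d → ifZero d 0 (b ∸ x)) Dx)
      cases : ∀ {d} → D r ≡ d → pair r (b ∸ r) ≡ n
      cases {zero}  e = dist≡0⇒≡ _ n e
      cases {suc d} e = ≡.trans (cong (λ z → pair z (b ∸ z)) r≡x) (dist≡0⇒≡ _ n Dx)
        where
        b≤r : b ≤ r
        b≤r = ℕₚ.m∸n≡0⇒m≤n (≡.trans (cong (λ d → ifZero d 0 (b ∸ r)) (sym e)) (proj₁ least))
        r≡x : r ≡ x
        r≡x = ℕₚ.≤-antisym r≤x (ℕₚ.≤-trans (ℕₚ.m≤m+n x y) b≤r)

    ⟨x-of⟩ : ∀ {n} {F G : Vec ℕ n → ℕ} → Recursive F → Recursive G → Recursive (λ xs → x-of (F xs) (G xs))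
    ⟨x-of⟩ = lift₂ (λ b n → proj₂ (proj₁ (proj₂ split)) (b ∷ n ∷ []))

    -- The least guess `b` for the sum of the coordinates at which the inner search succeeds. The
    -- true sum is such a guess, so the search halts; any guess that succeeds gives the right
    -- coordinates by injectivity of `pair`.
    total = ⟨mu⟩ {n = 1}
      (⟨dist⟩ (lift₂ pair-⇓ (⟨x-of⟩ (var zero) (var (suc zero)))
                            (var zero ⟨∸⟩ ⟨x-of⟩ (var zero) (var (suc zero))))
              (var (suc zero)))
      λ { (n ∷ []) → fst n + snd n , ≡.trans
        (cong (λ m → dist (pair (x-of (fst n + snd n) m) (fst n + snd n ∸ x-of (fst n + snd n) m)) m)
              (sym (pair-unpair n)))
        (≡.trans (cong (λ m → dist m (pair (fst n) (snd n))) (split-correct (fst n) (snd n)))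
                 (dist-refl (pair (fst n) (snd n)))) }

    total-correct : ∀ n → let b = proj₁ total (n ∷ []) in pair (x-of b n) (b ∸ x-of b n) ≡ n
    total-correct n = dist≡0⇒≡ _ n (proj₁ (proj₂ (proj₂ total) (n ∷ [])))

    ⟨total⟩ : ∀ {n} {F : Vec ℕ n → ℕ} → Recursive F → Recursive (λ xs → proj₁ total (F xs ∷ []))
    ⟨total⟩ = lift₁ (λ n → proj₁ total (n ∷ [])) (λ n → proj₂ (proj₁ (proj₂ total)) (n ∷ []))

  abstract
    ⟨fst⟩ : Recursive {1} (λ xs → fst (head xs))
    ⟨fst⟩ = recursive-resp (⟨x-of⟩ (⟨total⟩ (var zero)) (var zero)) λ { (n ∷ []) →
      proj₁ (pair-injective (≡.trans (total-correct n) (sym (pair-unpair n)))) }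

    ⟨snd⟩ : Recursive {1} (λ xs → snd (head xs))
    ⟨snd⟩ = recursive-resp (⟨total⟩ (var zero) ⟨∸⟩ ⟨x-of⟩ (⟨total⟩ (var zero)) (var zero)) λ { (n ∷ []) →
      proj₂ (pair-injective (≡.trans (total-correct n) (sym (pair-unpair n)))) }

  mutual
    encode : ∀ {n} → Rec n → ℕ
    encode zero              = pair 0 0
    encode succ              = pair 1 0
    encode (proj i)          = pair 2 (toℕ i)
    -- The type of `comp f gs` hides the arity `m`. Recording it lets injectivity identify the two
    -- arities before comparing the outer programs, whose types depend on them.
    encode (comp {m} f gs)   = pair 3 (pair m (pair (encode f) (encode* gs)))
    encode (prec f g)        = pair 4 (pair (encode f) (encode g))
    encode (mu f)            = pair 5 (encode f)

    encode* : ∀ {m n} → Vec (Rec n) m → ℕ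
    encode* []       = 0
    encode* (f ∷ fs) = pair (encode f) (encode* fs)

  private
    tags-differ : ∀ {t u x y} {A : Set} → ¬ t ≡ u → pair t x ≡ pair u y → A
    tags-differ t≢u e = ⊥-elim (t≢u (proj₁ (pair-injective e)))

  mutual
    encode-injective : ∀ {n} (f g : Rec n) → encode f ≡ encode g → f ≡ g
    encode-injective zero zero e = refl
    encode-injective succ succ e = refl
    encode-injective (proj i) (proj j) e = cong proj (toℕ-injective (proj₂ (pair-injective e)))
    encode-injective (comp f fs) (comp g gs) e with pair-injective (proj₂ (pair-injective e))
    ... | refl , e′ with pair-injective e′
    ...   | p , q = cong₂ comp (encode-injective f g p) (encode*-injective fs gs q)
    encode-injective (prec f f′) (prec g g′) e with pair-injective (proj₂ (pair-injective e))
    ... | p , q = cong₂ prec (encode-injective f g p) (encode-injective f′ g′ q)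
    encode-injective (mu f) (mu g) e = cong mu (encode-injective f g (proj₂ (pair-injective e)))
    encode-injective zero succ e = tags-differ (λ ()) e
    encode-injective zero (proj _) e = tags-differ (λ ()) e
    encode-injective zero (comp _ _) e = tags-differ (λ ()) e
    encode-injective zero (prec _ _) e = tags-differ (λ ()) e
    encode-injective zero (mu _) e = tags-differ (λ ()) e
    encode-injective succ zero e = tags-differ (λ ()) e
    encode-injective succ (proj _) e = tags-differ (λ ()) e
    encode-injective succ (comp _ _) e = tags-differ (λ ()) e
    encode-injective succ (prec _ _) e = tags-differ (λ ()) e
    encode-injective succ (mu _) e = tags-differ (λ ()) e
    encode-injective (proj _) zero e = tags-differ (λ ()) e
    encode-injective (proj _) succ e = tags-differ (λ ()) e
    encode-injective (proj _) (comp _ _) e = tags-differ (λ ()) e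
    encode-injective (proj _) (prec _ _) e = tags-differ (λ ()) e
    encode-injective (proj _) (mu _) e = tags-differ (λ ()) e
    encode-injective (comp _ _) zero e = tags-differ (λ ()) e
    encode-injective (comp _ _) succ e = tags-differ (λ ()) e
    encode-injective (comp _ _) (proj _) e = tags-differ (λ ()) e
    encode-injective (comp _ _) (prec _ _) e = tags-differ (λ ()) e
    encode-injective (comp _ _) (mu _) e = tags-differ (λ ()) e
    encode-injective (prec _ _) zero e = tags-differ (λ ()) e
    encode-injective (prec _ _) succ e = tags-differ (λ ()) e
    encode-injective (prec _ _) (proj _) e = tags-differ (λ ()) e
    encode-injective (prec _ _) (comp _ _) e = tags-differ (λ ()) e
    encode-injective (prec _ _) (mu _) e = tags-differ (λ ()) e
    encode-injective (mu _) zero e = tags-differ (λ ()) e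
    encode-injective (mu _) succ e = tags-differ (λ ()) e
    encode-injective (mu _) (proj _) e = tags-differ (λ ()) e
    encode-injective (mu _) (comp _ _) e = tags-differ (λ ()) e
    encode-injective (mu _) (prec _ _) e = tags-differ (λ ()) e

    encode*-injective : ∀ {m n} (fs gs : Vec (Rec n) m) → encode* fs ≡ encode* gs → fs ≡ gs
    encode*-injective []       []       e = refl
    encode*-injective (f ∷ fs) (g ∷ gs) e with pair-injective e
    ... | p , q = cong₂ _∷_ (encode-injective f g p) (encode*-injective fs gs q)

-- Cohesive powers

-- This is what `Values` asks of an order: the point fills undefined values, and the strict partial
-- order passes to the power. The coded sum and product are handled at this level.
record IsPointedOrder (L : ωOrder) : Set where
  field
    point : ∃ (dom L)
    isSPO : IsSPO ⌊ L ⌋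

  open IsStrictPartialOrder isSPO public

pointedOrder : (L : ωOrder) → ∃ (dom L) → (∀ {l} → l ∈ dom L → ¬ lt L l l) →
  (∀ {l m n} → l ∈ dom L → m ∈ dom L → n ∈ dom L → lt L l m → lt L m n → lt L l n) →
  IsPointedOrder L
pointedOrder L a irrefl trans = record
  { point = a
  ; isSPO = record
    { isEquivalence = record { refl = refl ; sym = sym ; trans = ≡.trans }
    ; irrefl        = λ { {l , l∈L} {.l , _} refl → irrefl l∈L }
    ; trans         = λ {l} {m} {n} → trans (proj₂ l) (proj₂ m) (proj₂ n)
    ; <-resp-≈      = (λ { {_} {_ , _} {_ , _} refl p → p }) , (λ { {_} {_ , _} {_ , _} refl p → p })
    }
  }

linear-isPointedOrder : (L : ComputableLinearOrder) → IsPointedOrder (order L)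
linear-isPointedOrder L = record
  { point = ComputableLinearOrder.nonempty L
  ; isSPO = IsStrictTotalOrder.isStrictPartialOrder (ComputableLinearOrder.isStrictTotalOrder L)
  }

Implements₁ : (L M : ωOrder) → Rec 1 → (∃ (dom L) → ∃ (dom M)) → Set
Implements₁ _ _ h H = ∀ a → h [ proj₁ a ∷ [] ]⇓ proj₁ (H a)

Implements₂ : (L M N : ωOrder) → Rec 2 → (∃ (dom L) → ∃ (dom M) → ∃ (dom N)) → Set
Implements₂ _ _ _ h H = ∀ a b → h [ proj₁ a ∷ proj₁ b ∷ [] ]⇓ proj₁ (H a b)

module Power (em : ExcludedMiddle 0ℓ) (C : Pred ℕ 0ℓ) (cohesive : Cohesive C) where

  AE : Pred ℕ 0ℓ → Set
  AE P = C ⊆* P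

  AE-all : {P : Pred ℕ 0ℓ} → (∀ x → P x) → AE P
  AE-all p = List.[] , λ (_ , ¬Px) → ⊥-elim (¬Px (p _))

  AE-map : {P Q : Pred ℕ 0ℓ} → (∀ {x} → P x → Q x) → AE P → AE Q
  AE-map p (xs , out) = xs , λ (x∈C , ¬Qx) → out (x∈C , λ Px → ¬Qx (p Px))

  -- An exception to `R` is an exception to `P` or, if `P` holds there, to `Q`. Excluded middle
  -- chooses, and the two finite lists are concatenated.
  AE-map₂ : {P Q R : Pred ℕ 0ℓ} → (∀ {x} → P x → Q x → R x) → AE P → AE Q → AE R
  AE-map₂ {P} p (xs , out) (ys , out′) = xs List.++ ys , λ {x} (x∈C , ¬Rx) →
    case-em (λ Px → ∈-++⁺ʳ xs (out′ (x∈C , λ Qx → ¬Rx (p Px Qx))))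
            (λ ¬Px → ∈-++⁺ˡ (out (x∈C , ¬Px)))
    where
    case-em : ∀ {x} {A : Set} → (P x → A) → (¬ P x → A) → A
    case-em {x} f g with em {P x}
    ... | yes p = f p
    ... | no ¬p = g ¬p

  AE-map₃ : {P Q R S : Pred ℕ 0ℓ} → (∀ {x} → P x → Q x → R x → S x) → AE P → AE Q → AE R → AE S
  AE-map₃ p u v w = AE-map₂ (λ f r → f r) (AE-map₂ (λ a b → p a b) u v) w

  AE-contradiction : {P : Pred ℕ 0ℓ} → (∀ {x} → ¬ P x) → ¬ AE P
  AE-contradiction ¬P (xs , out) = Cohesive.infinite cohesive (xs , λ x∈C → out (x∈C , ¬P))

  -- Cohesiveness is applied to the c.e. set of zeros of `g`. Off `C` this set may have nothing to
  -- do with `P`; agreement at almost all points of `C` transfers the result.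
  AE-decide : {P : Pred ℕ 0ℓ} (g : Rec 1) →
    AE (λ x → (P x × g [ x ∷ [] ]⇓ 0) ⊎ (¬ P x × ∃ λ v → g [ x ∷ [] ]⇓ suc v)) →
    AE P ⊎ AE (λ x → ¬ P x)
  AE-decide {P} g decides with Cohesive.cohesive cohesive {λ x → g [ x ∷ [] ]⇓ 0} (e , to , from)
    where
    e : Rec 1
    -- The search variable is ignored: the search stops at 0 if `g` vanishes at `x`, and diverges
    -- otherwise.
    e = mu (comp g (proj (suc zero) ∷ []))
    to : ∀ {x} → g [ x ∷ [] ]⇓ 0 → Dom e x
    to p = 0 , ⇓mu (⇓comp (⇓proj ∷ []) p) λ ()
    from : ∀ {x} → Dom e x → g [ x ∷ [] ]⇓ 0
    from (_ , ⇓mu (⇓comp (⇓proj ∷ []) p) _) = p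
  ... | inj₂ (xs , out) = inj₁ (AE-map₂ P-if decides (xs , λ (x∈C , ¬p) → out (¬p , x∈C)))
    where
    P-if : ∀ {x} → (P x × g [ x ∷ [] ]⇓ 0) ⊎ (¬ P x × ∃ λ v → g [ x ∷ [] ]⇓ suc v) →
      g [ x ∷ [] ]⇓ 0 → P x
    P-if (inj₁ (Px , _)) _ = Px
    P-if (inj₂ (_ , _ , q)) p with deterministic g p q
    ... | ()
  ... | inj₁ (xs , out) = inj₂ (AE-map₂ ¬P-if decides
          (xs , λ (x∈C , ¬¬p) → out (decidable-stable em ¬¬p , x∈C)))
    where
    ¬P-if : ∀ {x} → (P x × g [ x ∷ [] ]⇓ 0) ⊎ (¬ P x × ∃ λ v → g [ x ∷ [] ]⇓ suc v) →
      ¬ g [ x ∷ [] ]⇓ 0 → ¬ P x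
    ¬P-if (inj₁ (_ , p)) ¬p = ⊥-elim (¬p p)
    ¬P-if (inj₂ (¬Px , _)) _ = ¬Px

  module Values {L : ωOrder} (O : IsPointedOrder L) where
    open RawRelation (Π C L) public
    private
      module O = IsPointedOrder O

    -- A total extension of the partial function φ f.
    abstract
      val : Carrier → ℕ → ∃ (dom L)
      val f x with em {Dom (φ f) x}
      ... | yes (y , p) = y , range f p
      ... | no _        = O.point

      val-unique : ∀ f {x y} → φ f [ x ∷ [] ]⇓ y → y ≡ proj₁ (val f x)
      val-unique f {x} p with em {Dom (φ f) x}
      ... | yes (_ , q) = deterministic (φ f) p q
      ... | no ¬dom     = ⊥-elim (¬dom (_ , p))

    val-⇓ : ∀ f → AE (λ x → φ f [ x ∷ [] ]⇓ proj₁ (val f x))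
    val-⇓ f = AE-map (λ (y , p) → subst (φ f [ _ ]⇓_) (val-unique f p) p) (defined f)

    ≈⇒AE : ∀ f g → f ≈ g → AE (λ x → proj₁ (val f x) ≡ proj₁ (val g x))
    ≈⇒AE f g = AE-map λ (_ , p , q) → ≡.trans (sym (val-unique f p)) (val-unique g q)

    AE⇒≈ : ∀ f g → AE (λ x → proj₁ (val f x) ≡ proj₁ (val g x)) → f ≈ g
    AE⇒≈ f g = AE-map₃ (λ p q e → _ , subst (φ f [ _ ]⇓_) e p , q) (val-⇓ f) (val-⇓ g)

    <⇒AE : ∀ f g → f ∼ g → AE (λ x → lt L (proj₁ (val f x)) (proj₁ (val g x)))
    <⇒AE f g = AE-map λ (_ , _ , p , q , y<z) → subst₂ (lt L) (val-unique f p) (val-unique g q) y<z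

    AE⇒< : ∀ f g → AE (λ x → lt L (proj₁ (val f x)) (proj₁ (val g x))) → f ∼ g
    AE⇒< f g = AE-map₃ (λ p q y<z → _ , _ , p , q , y<z) (val-⇓ f) (val-⇓ g)

    Π-isSPO : IsSPO (Π C L)
    Π-isSPO = record
      { isEquivalence = record
        { refl  = λ {f} → AE⇒≈ f f (AE-all λ _ → refl)
        ; sym   = λ {f} {g} p → AE⇒≈ g f (AE-map sym (≈⇒AE f g p))
        ; trans = λ {f} {g} {h} p q → AE⇒≈ f h (AE-map₂ ≡.trans (≈⇒AE f g p) (≈⇒AE g h q))
        }
      ; irrefl = λ {f} {g} p q →
          AE-contradiction (λ ()) (AE-map₂ (λ {x} → O.irrefl {val f x} {val g x}) (≈⇒AE f g p) (<⇒AE f g q))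
      ; trans = λ {f} {g} {h} p q → AE⇒< f h
          (AE-map₂ (λ {x} → O.trans {val f x} {val g x} {val h x}) (<⇒AE f g p) (<⇒AE g h q))
      ; <-resp-≈ =
          (λ {f} {g} {h} p q → AE⇒< f h
            (AE-map₂ (λ e → subst (lt L _) e) (≈⇒AE g h p) (<⇒AE f g q))) ,
          (λ {f} {g} {h} p q → AE⇒< h f
            (AE-map₂ (λ e → subst (λ l → lt L l _) e) (≈⇒AE g h p) (<⇒AE g f q)))
      }

    constantly : ∃ (dom L) → Carrier
    constantly (a , a∈L) = record
      { φ       = proj₁ (constant a)
      ; range   = λ p → subst (dom L) (deterministic _ (proj₂ (constant a) _) p) a∈L
      ; defined = AE-all λ _ → _ , proj₂ (constant a) _
      }

    val-constantly : ∀ a x → proj₁ (val (constantly a) x) ≡ proj₁ a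
    val-constantly a x = sym (val-unique (constantly a) (proj₂ (constant (proj₁ a)) _))

  module _ {L M : ωOrder} (O : IsPointedOrder L) (P : IsPointedOrder M)
    (H : ∃ (dom L) → ∃ (dom M)) {h : Rec 1} (h⇓ : Implements₁ L M h H) where
    private
      module O = Values O
      module P = Values P

    map₁ : O.Carrier → P.Carrier
    map₁ f = record
      { φ       = comp h (φ f ∷ [])
      ; range   = λ { (⇓comp (p ∷ []) q) →
          subst (dom M) (deterministic h (h⇓ (_ , range f p)) q) (proj₂ (H (_ , range f p))) }
      ; defined = AE-map (λ p → _ , ⇓comp (p ∷ []) (h⇓ (O.val f _))) (O.val-⇓ f)
      }

    val-map₁ : ∀ f → AE (λ x → proj₁ (H (O.val f x)) ≡ proj₁ (P.val (map₁ f) x))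
    val-map₁ f = AE-map (λ p → P.val-unique (map₁ f) (⇓comp (p ∷ []) (h⇓ (O.val f _)))) (O.val-⇓ f)

    map₁-cong : ∀ f g → f O.≈ g → map₁ f P.≈ map₁ g
    map₁-cong f g = AE-map λ (_ , p , q) →
      _ , ⇓comp (p ∷ []) (h⇓ (_ , range f p)) , ⇓comp (q ∷ []) (h⇓ (_ , range f p))

    map₁-mono : (∀ a b → lt L (proj₁ a) (proj₁ b) → lt M (proj₁ (H a)) (proj₁ (H b))) →
      ∀ f g → f O.∼ g → map₁ f P.∼ map₁ g
    map₁-mono mono f g p = P.AE⇒< (map₁ f) (map₁ g)
      (AE-map₃ (λ {x} e e′ q → subst₂ (lt M) e e′ (mono (O.val f x) (O.val g x) q))
        (val-map₁ f) (val-map₁ g) (O.<⇒AE f g p))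

  module _ {L M N : ωOrder} (O : IsPointedOrder L) (P : IsPointedOrder M) (Q : IsPointedOrder N)
    (H : ∃ (dom L) → ∃ (dom M) → ∃ (dom N)) {h : Rec 2} (h⇓ : Implements₂ L M N h H) where
    private
      module O = Values O
      module P = Values P
      module Q = Values Q

    map₂ : O.Carrier → P.Carrier → Q.Carrier
    map₂ f g = record
      { φ       = comp h (φ f ∷ φ g ∷ [])
      ; range   = λ { (⇓comp (p ∷ q ∷ []) r) →
          subst (dom N) (deterministic h (h⇓ (_ , range f p) (_ , range g q)) r)
            (proj₂ (H (_ , range f p) (_ , range g q))) }
      ; defined = AE-map₂ (λ p q → _ , ⇓comp (p ∷ q ∷ []) (h⇓ (O.val f _) (P.val g _)))
          (O.val-⇓ f) (P.val-⇓ g)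
      }

    val-map₂ : ∀ f g → AE (λ x → proj₁ (H (O.val f x) (P.val g x)) ≡ proj₁ (Q.val (map₂ f g) x))
    val-map₂ f g = AE-map₂ (λ p q → Q.val-unique (map₂ f g)
      (⇓comp (p ∷ q ∷ []) (h⇓ (O.val f _) (P.val g _)))) (O.val-⇓ f) (P.val-⇓ g)

    map₂-cong : ∀ f f′ g g′ → f O.≈ f′ → g P.≈ g′ → map₂ f g Q.≈ map₂ f′ g′
    map₂-cong f f′ g g′ = AE-map₂ λ (_ , p , p′) (_ , q , q′) →
      _ , ⇓comp (p ∷ q ∷ []) (h⇓ (_ , range f p) (_ , range g q)) ,
          ⇓comp (p′ ∷ q′ ∷ []) (h⇓ (_ , range f p) (_ , range g q))

    map₂-mono : ∀ f f′ g g′ →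
      AE (λ x → lt N (proj₁ (H (O.val f x) (P.val g x))) (proj₁ (H (O.val f′ x) (P.val g′ x)))) →
      map₂ f g Q.∼ map₂ f′ g′
    map₂-mono f f′ g g′ p = Q.AE⇒< (map₂ f g) (map₂ f′ g′)
      (AE-map₃ (subst₂ (lt N)) (val-map₂ f g) (val-map₂ f′ g′) p)

  module Linear (L : ComputableLinearOrder) where
    open Values (linear-isPointedOrder L) public
    private
      open IsStrictPartialOrder Π-isSPO using (irrefl; asym; module Eq)
      module L = IsStrictTotalOrder (ComputableLinearOrder.isStrictTotalOrder L)

      Less : ∀ f g → Pred ℕ 0ℓ
      Less f g x = lt (order L) (proj₁ (val f x)) (proj₁ (val g x))

      decide-< : ∀ f g → AE (Less f g) ⊎ AE (λ x → ¬ Less f g x)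
      -- The program for the order outputs 0 when the relation fails, and `AE-decide` reads 0 as
      -- success; hence the negated property.
      decide-< f g with AE-decide {P = λ x → ¬ Less f g x} (comp c (φ f ∷ φ g ∷ []))
                          (AE-map₂ decides (val-⇓ f) (val-⇓ g))
        where
        c = proj₁ (ComputableLinearOrder.lt-computable L)
        decides : ∀ {x} → φ f [ x ∷ [] ]⇓ proj₁ (val f x) → φ g [ x ∷ [] ]⇓ proj₁ (val g x) →
          (¬ Less f g x × comp c (φ f ∷ φ g ∷ []) [ x ∷ [] ]⇓ 0) ⊎
          (¬ ¬ Less f g x × ∃ λ v → comp c (φ f ∷ φ g ∷ []) [ x ∷ [] ]⇓ suc v)
        decides {x} p q with proj₂ (ComputableLinearOrder.lt-computable L)
                               (proj₁ (val f x) ∷ proj₁ (val g x) ∷ [])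
        ... | inj₁ ((_ , _ , u) , r) = inj₂ ((λ ¬u → ¬u u) , 0 , ⇓comp (p ∷ q ∷ []) r)
        ... | inj₂ (¬u , r) = inj₁ ((λ u → ¬u (proj₂ (val f x) , proj₂ (val g x) , u)) ,
                                    ⇓comp (p ∷ q ∷ []) r)
      ... | inj₁ never = inj₂ never
      ... | inj₂ ¬¬p   = inj₁ (AE-map (decidable-stable em) ¬¬p)

    -- If neither strict inequality holds almost everywhere, both fail almost everywhere, and
    -- trichotomy in `L` leaves equality at each remaining point.
    Π-isSTO : IsSTO (Π C (order L))
    Π-isSTO = record { isStrictPartialOrder = Π-isSPO ; compare = compare }
      where
      compare : ∀ f g → _
      compare f g with decide-< f g
      ... | inj₁ f<g = tri< (AE⇒< f g f<g) (λ e → irrefl {f} {g} e (AE⇒< f g f<g))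
                            (asym {f} {g} (AE⇒< f g f<g))
      ... | inj₂ f≮g with decide-< g f
      ...   | inj₁ g<f = tri> (asym {g} {f} (AE⇒< g f g<f))
                (λ e → irrefl {g} {f} (Eq.sym {f} {g} e) (AE⇒< g f g<f)) (AE⇒< g f g<f)
      ...   | inj₂ g≮f = tri≈ (irrefl {f} {g} f≈g) f≈g (irrefl {g} {f} (Eq.sym {f} {g} f≈g))
        where
        equal : ∀ {x} → ¬ Less f g x → ¬ Less g f x → proj₁ (val f x) ≡ proj₁ (val g x)
        equal {x} p q with L.compare (val f x) (val g x)
        ... | tri< u _ _ = ⊥-elim (p u)
        ... | tri≈ _ e _ = e
        ... | tri> _ _ u = ⊥-elim (q u)
        f≈g : f ≈ g
        f≈g = AE⇒≈ f g (AE-map₂ equal f≮g g≮f)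

-- Sums, products and reverses

module SumAndProduct (em : ExcludedMiddle 0ℓ) (pairing : ComputablePairing)
  (L₀ L₁ : ComputableLinearOrder) (C : Pred ℕ 0ℓ) (cohesive : Cohesive C) where
  open Coded pairing
  open Pairing pairing
  open Power em C cohesive
  private
    module L₀ = ComputableLinearOrder L₀
    module L₁ = ComputableLinearOrder L₁
    module S₀ = IsStrictTotalOrder L₀.isStrictTotalOrder
    module S₁ = IsStrictTotalOrder L₁.isStrictTotalOrder
    module Π₀ = Linear L₀
    module Π₁ = Linear L₁
    O₀ = linear-isPointedOrder L₀
    O₁ = linear-isPointedOrder L₁
    sum prod : ωOrder
    sum  = L₀.order +ω L₁.order
    prod = L₀.order ×ω L₁.order

    sum-irrefl : ∀ {l} → l ∈ dom sum → ¬ lt sum l l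
    sum-irrefl {l} l∈ p with unpair l
    sum-irrefl l∈ (inj₁ i<i)     | i , _           = ℕₚ.<-irrefl refl i<i
    sum-irrefl l∈ (inj₂ (_ , p)) | 0 , a           = S₀.irrefl {a , l∈} {a , l∈} refl p
    sum-irrefl l∈ (inj₂ (_ , p)) | 1 , a           = S₁.irrefl {a , l∈} {a , l∈} refl p
    sum-irrefl () (inj₂ (_ , p)) | suc (suc _) , _

    sum-trans : ∀ {l m n} → l ∈ dom sum → m ∈ dom sum → n ∈ dom sum →
      lt sum l m → lt sum m n → lt sum l n
    sum-trans {l} {m} {n} l∈ m∈ n∈ p q with unpair l | unpair m | unpair n
    sum-trans l∈ m∈ n∈ (inj₁ p) (inj₁ q)                   | i , _ | j , _ | k , _ = inj₁ (ℕₚ.<-trans p q)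
    sum-trans l∈ m∈ n∈ (inj₁ p) (inj₂ (refl , _))          | i , _ | j , _ | .j , _ = inj₁ p
    sum-trans l∈ m∈ n∈ (inj₂ (refl , _)) (inj₁ q)          | i , _ | .i , _ | k , _ = inj₁ q
    sum-trans l∈ m∈ n∈ (inj₂ (refl , p)) (inj₂ (refl , q)) | 0 , a | .0 , b | .0 , c =
      inj₂ (refl , S₀.trans {a , l∈} {b , m∈} {c , n∈} p q)
    sum-trans l∈ m∈ n∈ (inj₂ (refl , p)) (inj₂ (refl , q)) | 1 , a | .1 , b | .1 , c =
      inj₂ (refl , S₁.trans {a , l∈} {b , m∈} {c , n∈} p q)
    sum-trans () m∈ n∈ (inj₂ (refl , p)) (inj₂ (refl , q)) | suc (suc _) , _ | _ , _ | _ , _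

    inl : ∃ (dom L₀.order) → ∃ (dom sum)
    inl (a , a∈) = pair 0 a , in-sum
      where
      in-sum : pair 0 a ∈ dom sum
      in-sum rewrite unpair-pair 0 a = a∈

    inr : ∃ (dom L₁.order) → ∃ (dom sum)
    inr (a , a∈) = pair 1 a , in-sum
      where
      in-sum : pair 1 a ∈ dom sum
      in-sum rewrite unpair-pair 1 a = a∈

    -- The projections take an arbitrary fixed value on the other summand.
    outl : ∃ (dom sum) → ∃ (dom L₀.order)
    outl (n , n∈) = ifZero (fst n) (snd n) (proj₁ L₀.nonempty) , in-L₀ n n∈
      where
      in-L₀ : ∀ n → n ∈ dom sum → ifZero (fst n) (snd n) (proj₁ L₀.nonempty) ∈ dom L₀.order
      in-L₀ n n∈ with unpair n
      ... | zero  , _ = n∈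
      ... | suc _ , _ = proj₂ L₀.nonempty

    outr : ∃ (dom sum) → ∃ (dom L₁.order)
    outr (n , n∈) = ifZero (fst n) (proj₁ L₁.nonempty) (snd n) , in-L₁ n n∈
      where
      in-L₁ : ∀ n → n ∈ dom sum → ifZero (fst n) (proj₁ L₁.nonempty) (snd n) ∈ dom L₁.order
      in-L₁ n n∈ with unpair n
      ... | 0 , _ = proj₂ L₁.nonempty
      ... | 1 , _ = n∈

    fst≡1 : ∀ {n} → n ∈ dom sum → ¬ fst n ≡ 0 → fst n ≡ 1
    fst≡1 {n} n∈ ≢0 with unpair n
    ... | 0 , _ = ⊥-elim (≢0 refl)
    ... | 1 , _ = refl

    inl-outl : ∀ n → fst n ≡ 0 → pair 0 (ifZero (fst n) (snd n) (proj₁ L₀.nonempty)) ≡ n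
    inl-outl n e = ≡.trans
      (cong₂ pair (sym e) (cong (λ i → ifZero i (snd n) (proj₁ L₀.nonempty)) e)) (pair-unpair n)

    inr-outr : ∀ n → fst n ≡ 1 → pair 1 (ifZero (fst n) (proj₁ L₁.nonempty) (snd n)) ≡ n
    inr-outr n e = ≡.trans
      (cong₂ pair (sym e) (cong (λ i → ifZero i (proj₁ L₁.nonempty) (snd n)) e)) (pair-unpair n)

    sumO : IsPointedOrder sum
    sumO = pointedOrder sum (inl L₀.nonempty) sum-irrefl sum-trans
    module ΠS = Values sumO

    inl-rec = lift₂ pair-⇓ (constant 0) (var {1} zero)
    inr-rec = lift₂ pair-⇓ (constant 1) (var {1} zero)
    outl-rec = ⟨ifZero⟩ ⟨fst⟩ ⟨snd⟩ (constant (proj₁ L₀.nonempty))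
    outr-rec = ⟨ifZero⟩ ⟨fst⟩ (constant (proj₁ L₁.nonempty)) ⟨snd⟩

    inl-⇓ : Implements₁ L₀.order sum (proj₁ inl-rec) inl
    inl-⇓ (a , _) = proj₂ inl-rec (a ∷ [])
    inr-⇓ : Implements₁ L₁.order sum (proj₁ inr-rec) inr
    inr-⇓ (a , _) = proj₂ inr-rec (a ∷ [])
    outl-⇓ : Implements₁ sum L₀.order (proj₁ outl-rec) outl
    outl-⇓ (n , _) = proj₂ outl-rec (n ∷ [])
    outr-⇓ : Implements₁ sum L₁.order (proj₁ outr-rec) outr
    outr-⇓ (n , _) = proj₂ outr-rec (n ∷ [])

    inl-mono : ∀ a b → lt L₀.order (proj₁ a) (proj₁ b) → lt sum (proj₁ (inl a)) (proj₁ (inl b))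
    inl-mono (a , _) (b , _) p rewrite unpair-pair 0 a | unpair-pair 0 b = inj₂ (refl , p)

    inr-mono : ∀ a b → lt L₁.order (proj₁ a) (proj₁ b) → lt sum (proj₁ (inr a)) (proj₁ (inr b))
    inr-mono (a , _) (b , _) p rewrite unpair-pair 1 a | unpair-pair 1 b = inj₂ (refl , p)

    inl<inr : ∀ a b → lt sum (proj₁ (inl a)) (proj₁ (inr b))
    inl<inr (a , _) (b , _) rewrite unpair-pair 0 a | unpair-pair 1 b = inj₁ (s≤s z≤n)

    inject : Π₀.Carrier ⊎ Π₁.Carrier → ΠS.Carrier
    inject (inj₁ f) = map₁ O₀ sumO inl inl-⇓ f
    inject (inj₂ g) = map₁ O₁ sumO inr inr-⇓ g

    inject-cong : ∀ {u v} → Sum.Pointwise Π₀._≈_ Π₁._≈_ u v → inject u ΠS.≈ inject v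
    inject-cong (Sum.inj₁ {f} {g} p) = map₁-cong O₀ sumO inl inl-⇓ f g p
    inject-cong (Sum.inj₂ {f} {g} p) = map₁-cong O₁ sumO inr inr-⇓ f g p

    inject-mono : ∀ {u v} → (Π₀._∼_ ⊎-< Π₁._∼_) u v → inject u ΠS.∼ inject v
    inject-mono (₁∼₁ {f} {g} p) = map₁-mono O₀ sumO inl inl-⇓ inl-mono f g p
    inject-mono (₂∼₂ {f} {g} p) = map₁-mono O₁ sumO inr inr-⇓ inr-mono f g p
    inject-mono (₁∼₂ {f} {g}) = ΠS.AE⇒< (map₁ O₀ sumO inl inl-⇓ f) (map₁ O₁ sumO inr inr-⇓ g)
      (AE-map₂ (λ {x} e e′ → subst₂ (lt sum) e e′ (inl<inr (Π₀.val f x) (Π₁.val g x)))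
        (val-map₁ O₀ sumO inl inl-⇓ f) (val-map₁ O₁ sumO inr inr-⇓ g))

    -- Cohesiveness fixes the tag of the values of `f` at almost all points of `C`. Projecting to
    -- that summand and injecting again changes `f` only where the tag is the other one, so the
    -- default of `outl` or `outr` does no harm.
    inject-onto : ∀ f → ∃ λ u → inject u ΠS.≈ f
    inject-onto f with AE-decide {P = λ x → fst (proj₁ (ΠS.val f x)) ≡ 0} (comp (proj₁ ⟨fst⟩) (φ f ∷ []))
                         (AE-map (λ p → decides refl (⇓comp (p ∷ []) (proj₂ ⟨fst⟩ (_ ∷ [])))) (ΠS.val-⇓ f))
      where
      decides : ∀ {x k} → fst (proj₁ (ΠS.val f x)) ≡ k →
        comp (proj₁ ⟨fst⟩) (φ f ∷ []) [ x ∷ [] ]⇓ fst (proj₁ (ΠS.val f x)) →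
        (fst (proj₁ (ΠS.val f x)) ≡ 0 × comp (proj₁ ⟨fst⟩) (φ f ∷ []) [ x ∷ [] ]⇓ 0) ⊎
        (¬ fst (proj₁ (ΠS.val f x)) ≡ 0 × ∃ λ v → comp (proj₁ ⟨fst⟩) (φ f ∷ []) [ x ∷ [] ]⇓ suc v)
      decides {k = zero}  e p = inj₁ (e , subst (comp (proj₁ ⟨fst⟩) (φ f ∷ []) [ _ ]⇓_) e p)
      decides {k = suc k} e p = inj₂ ((λ e′ → 0≢suc (≡.trans (sym e′) e)) ,
                                      k , subst (comp (proj₁ ⟨fst⟩) (φ f ∷ []) [ _ ]⇓_) e p)
        where
        0≢suc : ∀ {k} → ¬ 0 ≡ suc k
        0≢suc ()
    ... | inj₁ p = inj₁ f₀ , ΠS.AE⇒≈ (inject (inj₁ f₀)) f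
          (AE-map₃ (λ {x} e e′ q → ≡.trans (sym e)
              (≡.trans (cong (pair 0) (sym e′)) (inl-outl (proj₁ (ΠS.val f x)) q)))
            (val-map₁ O₀ sumO inl inl-⇓ f₀) (val-map₁ sumO O₀ outl outl-⇓ f) p)
      where f₀ = map₁ sumO O₀ outl outl-⇓ f
    ... | inj₂ p = inj₂ f₁ , ΠS.AE⇒≈ (inject (inj₂ f₁)) f
          (AE-map₃ (λ {x} e e′ q → ≡.trans (sym e)
              (≡.trans (cong (pair 1) (sym e′))
                (inr-outr (proj₁ (ΠS.val f x)) (fst≡1 (proj₂ (ΠS.val f x)) q))))
            (val-map₁ O₁ sumO inr inr-⇓ f₁) (val-map₁ sumO O₁ outr outr-⇓ f) p)
      where f₁ = map₁ sumO O₁ outr outr-⇓ f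

  Π-sum : Π C sum ≅ Π C L₀.order ⊕ Π C L₁.order
  Π-sum = ≅-sym (⊎-<-isStrictTotalOrder Π₀.Π-isSTO Π₁.Π-isSTO) ΠS.Π-isSPO
    (≅-intro (⊎-<-isStrictTotalOrder Π₀.Π-isSTO Π₁.Π-isSTO) ΠS.Π-isSPO
      inject inject-cong inject-mono inject-onto)

  private
    prod-irrefl : ∀ {l} → l ∈ dom prod → ¬ lt prod l l
    prod-irrefl (a∈ , _) (inj₁ p)       = S₀.irrefl {_ , a∈} {_ , a∈} refl p
    prod-irrefl (_ , b∈) (inj₂ (_ , p)) = S₁.irrefl {_ , b∈} {_ , b∈} refl p

    prod-trans : ∀ {l m n} → l ∈ dom prod → m ∈ dom prod → n ∈ dom prod →
      lt prod l m → lt prod m n → lt prod l n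
    prod-trans (l∈ , _) (m∈ , _) (n∈ , _) (inj₁ p) (inj₁ q) =
      inj₁ (S₀.trans {_ , l∈} {_ , m∈} {_ , n∈} p q)
    prod-trans _ _ _ (inj₁ p) (inj₂ (e , _)) = inj₁ (subst (lt L₀.order _) e p)
    prod-trans {n = n} _ _ _ (inj₂ (e , _)) (inj₁ q) = inj₁ (subst (λ k → lt L₀.order k (fst n)) (sym e) q)
    prod-trans (_ , l∈) (_ , m∈) (_ , n∈) (inj₂ (e , p)) (inj₂ (e′ , q)) =
      inj₂ (≡.trans e e′ , S₁.trans {_ , l∈} {_ , m∈} {_ , n∈} p q)

    couple : ∃ (dom L₀.order) → ∃ (dom L₁.order) → ∃ (dom prod)
    couple (a , a∈) (b , b∈) = pair a b , in-prod
      where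
      in-prod : pair a b ∈ dom prod
      in-prod rewrite unpair-pair a b = a∈ , b∈

    prodO : IsPointedOrder prod
    prodO = pointedOrder prod (couple L₀.nonempty L₁.nonempty) prod-irrefl prod-trans
    module ΠP = Values prodO

    fst-prod : ∃ (dom prod) → ∃ (dom L₀.order)
    fst-prod (n , n∈) = fst n , proj₁ n∈

    snd-prod : ∃ (dom prod) → ∃ (dom L₁.order)
    snd-prod (n , n∈) = snd n , proj₂ n∈

    couple-⇓ : Implements₂ L₀.order L₁.order prod pair-rec couple
    couple-⇓ (a , _) (b , _) = pair-⇓ a b
    fst-⇓ : Implements₁ prod L₀.order (proj₁ ⟨fst⟩) fst-prod
    fst-⇓ (n , _) = proj₂ ⟨fst⟩ (n ∷ [])
    snd-⇓ : Implements₁ prod L₁.order (proj₁ ⟨snd⟩) snd-prod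
    snd-⇓ (n , _) = proj₂ ⟨snd⟩ (n ∷ [])

    tuple : Π₀.Carrier × Π₁.Carrier → ΠP.Carrier
    tuple (f , g) = map₂ O₀ O₁ prodO couple couple-⇓ f g

    pair-mono : ∀ {a a′ b b′} → ×-Lex _≡_ (lt L₀.order) (lt L₁.order) (a , b) (a′ , b′) →
      lt prod (pair a b) (pair a′ b′)
    pair-mono {a} {a′} {b} {b′} p rewrite unpair-pair a b | unpair-pair a′ b′ = p

    tuple-mono : ∀ {u v} → ×-Lex Π₀._≈_ Π₀._∼_ Π₁._∼_ u v → tuple u ΠP.∼ tuple v
    tuple-mono {f , g} {f′ , g′} (inj₁ p) =
      map₂-mono O₀ O₁ prodO couple couple-⇓ f f′ g g′ (AE-map (λ q → pair-mono (inj₁ q)) (Π₀.<⇒AE f f′ p))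
    tuple-mono {f , g} {f′ , g′} (inj₂ (e , p)) =
      map₂-mono O₀ O₁ prodO couple couple-⇓ f f′ g g′
        (AE-map₂ (λ d q → pair-mono (inj₂ (d , q))) (Π₀.≈⇒AE f f′ e) (Π₁.<⇒AE g g′ p))

    tuple-onto : ∀ f → ∃ λ u → tuple u ΠP.≈ f
    tuple-onto f = (f₀ , f₁) , ΠP.AE⇒≈ (tuple (f₀ , f₁)) f
      (AE-map₃ (λ e e₀ e₁ → ≡.trans (sym e)
          (≡.trans (cong₂ pair (sym e₀) (sym e₁)) (pair-unpair _)))
        (val-map₂ O₀ O₁ prodO couple couple-⇓ f₀ f₁) (val-map₁ prodO O₀ fst-prod fst-⇓ f) (val-map₁ prodO O₁ snd-prod snd-⇓ f))
      where
      f₀ = map₁ prodO O₀ fst-prod fst-⇓ f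
      f₁ = map₁ prodO O₁ snd-prod snd-⇓ f

  Π-product : Π C prod ≅ Π C L₀.order ⊗ Π C L₁.order
  Π-product = ≅-sym (×-isStrictTotalOrder Π₀.Π-isSTO Π₁.Π-isSTO) ΠP.Π-isSPO
    (≅-intro (×-isStrictTotalOrder Π₀.Π-isSTO Π₁.Π-isSTO) ΠP.Π-isSPO
      tuple (λ { {f , g} {f′ , g′} (p , q) → map₂-cong O₀ O₁ prodO couple couple-⇓ f f′ g g′ p q })
      (λ {u} {v} → tuple-mono {u} {v}) tuple-onto)

-- The programs stay the same; what changes is the order in which the two values are quantified in
-- the strict relation.
Π-reverse : (L : ωOrder) (C : Pred ℕ 0ℓ) → Π C (revω L) ≅ rev (Π C L)
Π-reverse L C = (λ f → record { φ = φ f ; range = range f ; defined = defined f }) , record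
  { isOrderMonomorphism = record
    { isOrderHomomorphism = record { cong = λ e → e ; mono = swap-witnesses }
    ; injective = λ e → e
    ; cancel = swap-witnesses
    }
  ; surjective = λ f → record { φ = φ f ; range = range f ; defined = defined f } , λ e → e
  }
  where
  swap-witnesses : {C : Pred ℕ 0ℓ} {P Q : ℕ → ℕ → Set} {R : ℕ → ℕ → Set} →
    C ⊆* (λ x → ∃₂ λ y z → P x y × Q x z × R z y) → C ⊆* (λ x → ∃₂ λ z y → Q x z × P x y × R z y)
  swap-witnesses (xs , out) = xs , λ (x∈C , ¬p) →
    out (x∈C , λ (y , z , p , q , r) → ¬p (z , y , q , p , r))

-- Dense orders

module _ {n} {R : Pred (Vec ℕ n) 0ℓ} (computable : Computable R) where

  -- 0 on R and 1 off R, so that a search for a zero is a search for a member of R.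
  miss : Vec ℕ n → ℕ
  miss xs with proj₂ computable xs
  ... | inj₁ _ = 0
  ... | inj₂ _ = 1

  ⟨miss⟩ : Recursive miss
  ⟨miss⟩ = recursive-resp (constant 1 ⟨∸⟩ (proj₁ computable , output-⇓)) correct
    where
    output : Vec ℕ n → ℕ
    output xs = [ (λ _ → 1) , (λ _ → 0) ]′ (proj₂ computable xs)
    output-⇓ : ∀ xs → proj₁ computable [ xs ]⇓ output xs
    output-⇓ xs with proj₂ computable xs
    ... | inj₁ (_ , p) = p
    ... | inj₂ (_ , p) = p
    correct : ∀ xs → 1 ∸ output xs ≡ miss xs
    correct xs with proj₂ computable xs
    ... | inj₁ _ = refl
    ... | inj₂ _ = refl

  miss≡0⇒ : ∀ {xs} → miss xs ≡ 0 → R xs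
  miss≡0⇒ {xs} e with proj₂ computable xs
  ... | inj₁ (r , _) = r

  ⇒miss≡0 : ∀ {xs} → R xs → miss xs ≡ 0
  ⇒miss≡0 {xs} r with proj₂ computable xs
  ... | inj₁ _        = refl
  ... | inj₂ (¬r , _) = ⊥-elim (¬r r)

module DenseSearch (L : ComputableLinearOrder) (dwe : DenseWithoutEndpoints (order L)) where
  open ComputableLinearOrder L hiding (order)
  private
    A : Set
    A = ∃ (dom (order L))

    missLt : ℕ → ℕ → ℕ
    missLt x y = miss lt-computable (x ∷ y ∷ [])

    missDom : ℕ → ℕ
    missDom x = miss dom-computable (x ∷ [])

    ⟨missLt⟩ : ∀ {n} {F G : Vec ℕ n → ℕ} → Recursive F → Recursive G → Recursive (λ xs → missLt (F xs) (G xs))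
    ⟨missLt⟩ = lift₂ λ x y → proj₂ (⟨miss⟩ lt-computable) (x ∷ y ∷ [])

    ⟨missDom⟩ : ∀ {n} {F : Vec ℕ n → ℕ} → Recursive F → Recursive (λ xs → missDom (F xs))
    ⟨missDom⟩ = lift₁ missDom λ x → proj₂ (⟨miss⟩ dom-computable) (x ∷ [])

    -- The relation decided by `lt-computable` includes membership in the domain, so a number found
    -- by a search for `<` is automatically an element of the order.
    less : ∀ {x y} → missLt x y ≡ 0 → x ∈ dom (order L) × y ∈ dom (order L) × lt (order L) x y
    less = miss≡0⇒ lt-computable

    less⁻ : ∀ (a b : A) → lt (order L) (proj₁ a) (proj₁ b) → missLt (proj₁ a) (proj₁ b) ≡ 0
    less⁻ (_ , a∈) (_ , b∈) p = ⇒miss≡0 lt-computable (a∈ , b∈ , p)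

    above-zero : ∀ a → ∃ (LeastZero λ z → missLt (proj₁ a) z)
    above-zero a with proj₂ (proj₂ dwe a)
    ... | b , a<b = least-zero _ (proj₁ b) (less⁻ a b a<b)

    below-zero : ∀ a → ∃ (LeastZero λ z → missLt z (proj₁ a))
    below-zero a with proj₁ (proj₂ dwe a)
    ... | b , b<a = least-zero _ (proj₁ b) (less⁻ b a b<a)

    -- Accepting any element of the domain if x is not below y keeps the search total.
    candidate : ℕ → ℕ → ℕ → ℕ
    candidate z x y = ifZero (missLt x y) (missLt x z + missLt z y) (missDom z)

    between-zero : ∀ a b → ∃ (LeastZero λ z → candidate z (proj₁ a) (proj₁ b))
    between-zero a b = by-cases _ refl
      where
      by-cases : ∀ k → missLt (proj₁ a) (proj₁ b) ≡ k → ∃ (LeastZero λ z → candidate z (proj₁ a) (proj₁ b))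
      by-cases zero e with proj₁ dwe {a} {b} (proj₂ (proj₂ (less e)))
      ... | c , a<c , c<b = least-zero _ (proj₁ c) (≡.trans
            (cong (λ k → ifZero k (missLt (proj₁ a) (proj₁ c) + missLt (proj₁ c) (proj₁ b)) (missDom (proj₁ c))) e)
            (cong₂ _+_ (less⁻ a c a<c) (less⁻ c b c<b)))
      by-cases (suc k) e = least-zero _ (proj₁ nonempty) (≡.trans
        (cong (λ k → ifZero k (missLt (proj₁ a) (proj₁ nonempty) + missLt (proj₁ nonempty) (proj₁ b))
          (missDom (proj₁ nonempty))) e)
        (⇒miss≡0 dom-computable (proj₂ nonempty)))

    candidate-∈ : ∀ k {x y z} → ifZero k (missLt x z + missLt z y) (missDom z) ≡ 0 → z ∈ dom (order L)
    candidate-∈ zero    {x} {y} {z} e = proj₁ (proj₂ (less (ℕₚ.m+n≡0⇒m≡0 (missLt x z) e)))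
    candidate-∈ (suc k) {x} {y} {z} e = miss≡0⇒ dom-computable e

    above-rec = ⟨missLt⟩ (var {2} (suc zero)) (var zero)
    below-rec = ⟨missLt⟩ (var {2} zero) (var (suc zero))
    between-rec = ⟨ifZero⟩ (⟨missLt⟩ (var {3} (suc zero)) (var (suc (suc zero))))
      (⟨missLt⟩ (var (suc zero)) (var zero) ⟨+⟩ ⟨missLt⟩ (var zero) (var (suc (suc zero))))
      (⟨missDom⟩ (var zero))

  above below : A → A
  above a = proj₁ (above-zero a) , proj₁ (proj₂ (less (proj₁ (proj₂ (above-zero a)))))
  below a = proj₁ (below-zero a) , proj₁ (less (proj₁ (proj₂ (below-zero a))))

  mid : A → A → A
  mid a b = proj₁ (between-zero a b) ,
    candidate-∈ (missLt (proj₁ a) (proj₁ b)) (proj₁ (proj₂ (between-zero a b)))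

  <-above : ∀ a → lt (order L) (proj₁ a) (proj₁ (above a))
  <-above a = proj₂ (proj₂ (less (proj₁ (proj₂ (above-zero a)))))

  below-< : ∀ a → lt (order L) (proj₁ (below a)) (proj₁ a)
  below-< a = proj₂ (proj₂ (less (proj₁ (proj₂ (below-zero a)))))

  mid-< : ∀ a b → lt (order L) (proj₁ a) (proj₁ b) →
    lt (order L) (proj₁ a) (proj₁ (mid a b)) × lt (order L) (proj₁ (mid a b)) (proj₁ b)
  mid-< a b a<b = proj₂ (proj₂ (less (ℕₚ.m+n≡0⇒m≡0 (missLt x z) e))) ,
                  proj₂ (proj₂ (less (ℕₚ.m+n≡0⇒n≡0 (missLt x z) e)))
    where
    x y z : ℕ
    x = proj₁ a
    y = proj₁ b
    z = proj₁ (mid a b)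
    e : missLt x z + missLt z y ≡ 0
    e = ≡.trans (sym (cong (λ k → ifZero k (missLt x z + missLt z y) (missDom z)) (less⁻ a b a<b)))
                (proj₁ (proj₂ (between-zero a b)))

  above-⇓ : Implements₁ (order L) (order L) (mu (proj₁ above-rec)) above
  above-⇓ a = mu-⇓ above-rec (proj₂ (above-zero a))

  below-⇓ : Implements₁ (order L) (order L) (mu (proj₁ below-rec)) below
  below-⇓ a = mu-⇓ below-rec (proj₂ (below-zero a))

  mid-⇓ : Implements₂ (order L) (order L) (order L) (mu (proj₁ between-rec)) mid
  mid-⇓ a b = mu-⇓ between-rec (proj₂ (between-zero a b))

module DensePower (em : ExcludedMiddle 0ℓ) (pairing : ComputablePairing)
  (L : ComputableLinearOrder) (dwe : DenseWithoutEndpoints (order L))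
  (C : Pred ℕ 0ℓ) (cohesive : Cohesive C) where
  open ComputableLinearOrder L using (nonempty)
  open Pairing pairing
  open Power em C cohesive
  open Linear L
  open DenseSearch L dwe
  private
    O = linear-isPointedOrder L

  order-isCountableDense : IsCountableDense ⌊ order L ⌋
  order-isCountableDense = record
    { isStrictTotalOrder = ComputableLinearOrder.isStrictTotalOrder L
    ; dense              = λ {a} {b} → proj₁ dwe {a} {b}
    ; noEndpoints        = proj₂ dwe
    ; point              = nonempty
    ; code               = proj₁
    ; code-injective     = λ e → e
    }

  Π-isCountableDense : IsCountableDense (Π C (order L))
  Π-isCountableDense = record
    { isStrictTotalOrder = Π-isSTO
    ; dense              = λ {f} {g} f<g → map₂ O O O mid mid-⇓ f g , dense f g f<g
    ; noEndpoints        = λ f →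
        (map₁ O O below below-⇓ f , AE⇒< (map₁ O O below below-⇓ f) f
          (AE-map (λ e → subst (λ l → lt (order L) l _) e (below-< (val f _))) (val-map₁ O O below below-⇓ f))) ,
        (map₁ O O above above-⇓ f , AE⇒< f (map₁ O O above above-⇓ f)
          (AE-map (λ e → subst (lt (order L) _) e (<-above (val f _))) (val-map₁ O O above above-⇓ f)))
    ; point              = constantly nonempty
    ; code               = λ f → encode (φ f)
    ; code-injective     = λ {f} {g} e → AE-map
        (λ (y , p) → y , p , subst (_[ _ ]⇓ y) (encode-injective (φ f) (φ g) e) p) (defined f)
    }
    where
    dense : ∀ f g → f ∼ g → f ∼ map₂ O O O mid mid-⇓ f g × map₂ O O O mid mid-⇓ f g ∼ g
    dense f g f<g =
      AE⇒< f (map₂ O O O mid mid-⇓ f g) (AE-map₂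
        (λ e p → subst (lt (order L) _) e (proj₁ (mid-< (val f _) (val g _) p)))
        (val-map₂ O O O mid mid-⇓ f g) (<⇒AE f g f<g)) ,
      AE⇒< (map₂ O O O mid mid-⇓ f g) g (AE-map₂
        (λ e p → subst (λ l → lt (order L) l _) e (proj₂ (mid-< (val f _) (val g _) p)))
        (val-map₂ O O O mid mid-⇓ f g) (<⇒AE f g f<g))

  Π-dense : ⌊ order L ⌋ ≅ Π C (order L)
  Π-dense = cantor em order-isCountableDense Π-isCountableDense

-- The power of ℕ

<-replaceˡ : ∀ {a b c} → a ≡ b → a < c → b < c
<-replaceˡ refl p = p

<-replaceʳ : ∀ {a b c} → a ≡ b → c < a → c < b
<-replaceʳ refl p = p

≤-replaceˡ : ∀ {a b c} → a ≡ b → a ≤ c → b ≤ c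
≤-replaceˡ refl p = p

ℕω : ωOrder
ℕω = record { dom = λ _ → ⊤ ; lt = _<_ }

ℕ-linear : ComputableLinearOrder
ℕ-linear = record
  { order = ℕω
  ; isComputableLinearOrder = record
    { nonempty           = 0 , tt
    ; isStrictTotalOrder = On.isStrictTotalOrder proj₁ ℕₚ.<-isStrictTotalOrder
    ; dom-computable     = proj₁ (constant 1) , λ { (x ∷ []) → inj₁ (tt , proj₂ (constant 1) _) }
    ; lt-computable      = proj₁ less-rec , λ { (x ∷ y ∷ []) → computes x y }
    }
  }
  where
  less-rec = ⟨ifZero⟩ (lift₁ suc (λ _ → ⇓succ) (var {2} zero) ⟨∸⟩ var (suc zero)) (constant 1) (constant 0)
  computes : ∀ x y → (⊤ × ⊤ × x < y) × proj₁ less-rec [ x ∷ y ∷ [] ]⇓ 1 ⊎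
                     ¬ (⊤ × ⊤ × x < y) × proj₁ less-rec [ x ∷ y ∷ [] ]⇓ 0
  computes x y with suc x ∸ y in e | proj₂ less-rec (x ∷ y ∷ [])
  ... | zero  | p = inj₁ ((tt , tt , ℕₚ.m∸n≡0⇒m≤n e) , p)
  ... | suc _ | p = inj₂ ((λ (_ , _ , x<y) → suc≢0 (≡.trans (sym e) (ℕₚ.m≤n⇒m∸n≡0 x<y))) , p)
    where
    suc≢0 : ∀ {k} → ¬ suc k ≡ 0
    suc≢0 ()

-- Midpoints and integer shifts of natural numbers

module _ {a b m : ℕ} (lower : a + b ≤ m + m) where

  midpoint-> : ∀ {k} → a + (k + k) < b → a + k < m
  midpoint-> {k} p = ℕₚ.≰⇒> λ m≤a+k → ℕₚ.<⇒≱ p (ℕₚ.+-cancelˡ-≤ a _ _ (begin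
    a + b             ≤⟨ lower ⟩
    m + m             ≤⟨ ℕₚ.+-mono-≤ m≤a+k m≤a+k ⟩
    a + k + (a + k)   ≡⟨ solve 2 (λ a k → a :+ k :+ (a :+ k) := a :+ (a :+ (k :+ k))) refl a k ⟩
    a + (a + (k + k)) ∎))
    where
    open ℕₚ.≤-Reasoning
    open +-*-Solver

  -- If `b ≤ m + k`, doubling gives `b + b ≤ suc (a + b) + (k + k)`, against the assumption after
  -- cancelling `b`. The extra `suc` pays for rounding the midpoint up.
  midpoint-< : ∀ {k} → m + m ≤ suc (a + b) → a + suc (k + k) < b → m + k < b
  midpoint-< {k} upper p = ℕₚ.≰⇒> λ b≤m+k → ℕₚ.<⇒≱ p (ℕₚ.+-cancelʳ-≤ b _ _ (begin
    b + b                 ≤⟨ ℕₚ.+-mono-≤ b≤m+k b≤m+k ⟩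
    m + k + (m + k)       ≡⟨ solve 2 (λ m k → m :+ k :+ (m :+ k) := m :+ m :+ (k :+ k)) refl m k ⟩
    m + m + (k + k)       ≤⟨ ℕₚ.+-monoˡ-≤ (k + k) upper ⟩
    suc (a + b) + (k + k) ≡⟨ solve 3 (λ a b k → con 1 :+ (a :+ b) :+ (k :+ k) :=
                                                a :+ (con 1 :+ (k :+ k)) :+ b) refl a b k ⟩
    a + suc (k + k) + b   ∎))
    where
    open ℕₚ.≤-Reasoning
    open +-*-Solver

private
  -- Half of `a + b`, rounded up, found as the least `m` with `a + b ≤ m + m`; this avoids
  -- programming a division.
  midpoint-search = ⟨mu⟩ {n = 2}
    ((var (suc zero) ⟨+⟩ var (suc (suc zero))) ⟨∸⟩ (var zero ⟨+⟩ var zero))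
    λ { (a ∷ b ∷ []) → a + b , ℕₚ.m≤n⇒m∸n≡0 (ℕₚ.m≤m+n (a + b) (a + b)) }

abstract
  midpoint : ℕ → ℕ → ℕ
  midpoint a b = proj₁ midpoint-search (a ∷ b ∷ [])

  midpoint-rec : Rec 2
  midpoint-rec = proj₁ (proj₁ (proj₂ midpoint-search))

  midpoint-⇓ : Computes₂ midpoint-rec midpoint
  midpoint-⇓ a b = proj₂ (proj₁ (proj₂ midpoint-search)) (a ∷ b ∷ [])

  midpoint-lower : ∀ a b → a + b ≤ midpoint a b + midpoint a b
  midpoint-lower a b = ℕₚ.m∸n≡0⇒m≤n (proj₁ (proj₂ (proj₂ midpoint-search) (a ∷ b ∷ [])))

  midpoint-upper : ∀ a b → midpoint a b + midpoint a b ≤ suc (a + b)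
  midpoint-upper a b = from-least (proj₂ (proj₂ midpoint-search) (a ∷ b ∷ []))
    where
    from-least : ∀ {m} → LeastZero (λ y → a + b ∸ (y + y)) m → m + m ≤ suc (a + b)
    from-least {zero}  _     = z≤n
    -- By minimality `m` is not a zero, so `m + m < a + b`.
    from-least {suc m} least = s≤s (subst (_≤ a + b) (sym (ℕₚ.+-suc m m)) (ℕₚ.≰⇒> λ a+b≤m+m →
      ℕₚ.<-irrefl refl (least-≤ least (ℕₚ.m≤n⇒m∸n≡0 a+b≤m+m))))

-- Translation by an integer, truncated at 0. Along a nonstandard element the truncation is felt at
-- only finitely many points of `C`.
shift : ℤ → ℕ → ℕ
shift (+ n)      a = a + n
shift (-[1+ n ]) a = a ∸ suc n

⟨shift⟩ : ∀ z → Recursive {1} (λ xs → shift z (head xs))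
⟨shift⟩ (+ n)      = recursive-resp (var zero ⟨+⟩ constant n) λ { (_ ∷ []) → refl }
⟨shift⟩ (-[1+ n ]) = recursive-resp (var zero ⟨∸⟩ constant (suc n)) λ { (_ ∷ []) → refl }

shift-upper : ∀ z a → shift z a ≤ a + ℤ.∣ z ∣
shift-upper (+ n)      a = ℕₚ.≤-refl
shift-upper (-[1+ n ]) a = ℕₚ.≤-trans (ℕₚ.m∸n≤m a (suc n)) (ℕₚ.m≤m+n a (suc n))

shift-lower : ∀ z a → a ≤ shift z a + ℤ.∣ z ∣
shift-lower (+ n)      a = ℕₚ.≤-trans (ℕₚ.m≤m+n a n) (ℕₚ.m≤m+n (a + n) n)
shift-lower (-[1+ n ]) a = subst (a ≤_) (ℕₚ.+-comm (suc n) _) (ℕₚ.m≤n+m∸n a (suc n))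

-- The bound on `ℤ.∣ z ∣` keeps subtraction from being truncated, since different negative shifts
-- could otherwise all give 0. In the mixed case it provides `a` positive.
shift-mono-ℤ : ∀ {z z′ a} → z ℤ.< z′ → ℤ.∣ z ∣ < a → shift z a < shift z′ a
shift-mono-ℤ {a = a} (ℤ.-<- {m} {n} n<m) m<a =
  ℕₚ.∸-monoʳ-< {a} {suc m} {suc n} (s≤s n<m) (ℕₚ.<⇒≤ m<a)
shift-mono-ℤ {a = suc a} (ℤ.-<+ {m} {n}) _ =
  s≤s (ℕₚ.≤-trans (ℕₚ.m∸n≤m a m) (ℕₚ.m≤m+n a n))
shift-mono-ℤ {a = a} (ℤ.+<+ m<n) _ = ℕₚ.+-monoʳ-< a m<n

-- A shift moves a number by at most its absolute value, so the two shifts together cannot close a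
-- gap larger than the sum of these.
shift-mono-far : ∀ z z′ {a b} → a + (ℤ.∣ z ∣ + ℤ.∣ z′ ∣) < b → shift z a < shift z′ b
shift-mono-far z z′ {a} {b} p = ℕₚ.+-cancelʳ-< ℤ.∣ z′ ∣ _ _ (begin-strict
  shift z a + ℤ.∣ z′ ∣         ≤⟨ ℕₚ.+-monoˡ-≤ _ (shift-upper z a) ⟩
  a + ℤ.∣ z ∣ + ℤ.∣ z′ ∣       ≡⟨ ℕₚ.+-assoc a _ _ ⟩
  a + (ℤ.∣ z ∣ + ℤ.∣ z′ ∣)     <⟨ p ⟩
  b                            ≤⟨ shift-lower z′ b ⟩
  shift z′ b + ℤ.∣ z′ ∣        ∎)
  where open ℕₚ.≤-Reasoning

shift-⊖ : ∀ n l a → shift (n ℤ.⊖ l) a ≡ a + n ∸ l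
shift-⊖ n       zero    a = refl
shift-⊖ zero    (suc l) a = cong (_∸ suc l) (sym (ℕₚ.+-identityʳ a))
shift-⊖ (suc n) (suc l) a = ≡.trans (cong (λ z → shift z a) (ℤₚ.[1+m]⊖[1+n]≡m⊖n n l))
  (≡.trans (shift-⊖ n l a) (cong (_∸ suc l) (sym (ℕₚ.+-suc a n))))

-- Raising `f` by `l` puts it at or above `r`, so the truncated difference `n` is exact and `f`
-- equals `r + n - l`. The intermediate values are variables so that equations known pointwise can
-- be matched.
shift-difference : ∀ r {f l y d n} → r ≤ f + l → f + l ≡ y → y ∸ r ≡ d → d ≡ n →
  shift (n ℤ.⊖ l) r ≡ f
shift-difference r {f} {l} {n = n} r≤f+l refl refl refl = begin
  shift (n ℤ.⊖ l) r      ≡⟨ shift-⊖ n l r ⟩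
  r + (f + l ∸ r) ∸ l    ≡⟨ cong (_∸ l) (ℕₚ.m+[n∸m]≡n r≤f+l) ⟩
  f + l ∸ l              ≡⟨ ℕₚ.m+n∸n≡m f l ⟩
  f                      ∎
  where open ≡.≡-Reasoning

-- Standard elements and blocks in the power of `ℕ`

module ℕPower (em : ExcludedMiddle 0ℓ) (pairing : ComputablePairing)
  (C : Pred ℕ 0ℓ) (cohesive : Cohesive C) where
  open Pairing pairing
  open Power em C cohesive
  open Linear ℕ-linear public
  private
    O = linear-isPointedOrder ℕ-linear
    P = Carrier

  v : P → ℕ → ℕ
  v f x = proj₁ (val f x)

  apply : {F : ℕ → ℕ} → Recursive {1} (λ xs → F (head xs)) → P → P
  apply {F} r = map₁ O O (λ a → F (proj₁ a) , tt) {proj₁ r} λ a → proj₂ r (proj₁ a ∷ [])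

  v-apply : {F : ℕ → ℕ} (r : Recursive {1} (λ xs → F (head xs))) (f : P) →
    AE (λ x → F (v f x) ≡ v (apply {F} r f) x)
  v-apply {F} r = val-map₁ O O (λ a → F (proj₁ a) , tt) {proj₁ r} λ a → proj₂ r (proj₁ a ∷ [])

  apply₂ : {F : ℕ → ℕ → ℕ} {r : Rec 2} → Computes₂ r F → P → P → P
  apply₂ {F} {r} r⇓ = map₂ O O O (λ a b → F (proj₁ a) (proj₁ b) , tt) {r} λ a b → r⇓ (proj₁ a) (proj₁ b)

  v-apply₂ : {F : ℕ → ℕ → ℕ} {r : Rec 2} (r⇓ : Computes₂ r F) (f g : P) →
    AE (λ x → F (v f x) (v g x) ≡ v (apply₂ {F} {r} r⇓ f g) x)
  v-apply₂ {F} {r} r⇓ = val-map₂ O O O (λ a b → F (proj₁ a) (proj₁ b) , tt) {r} λ a b → r⇓ (proj₁ a) (proj₁ b)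

  shifted : ℤ → P → P
  shifted z = apply {shift z} (⟨shift⟩ z)

  v-shifted : ∀ z f → AE (λ x → shift z (v f x) ≡ v (shifted z f) x)
  v-shifted z = v-apply {shift z} (⟨shift⟩ z)

  standard : ℕ → P
  standard n = constantly (n , tt)

  v-standard : ∀ n x → v (standard n) x ≡ n
  v-standard n = val-constantly (n , tt)

  infix 4 _≪_ _≲_

  _≪_ : P → P → Set
  f ≪ g = ∀ k → AE (λ x → v f x + k < v g x)

  _≲_ : P → P → Set
  f ≲ g = ∃ λ k → AE (λ x → v f x ≤ v g x + k)

  Nonstandard : P → Set
  Nonstandard f = ∀ k → AE (λ x → k < v f x)

  -- The translate of `f` by `k` is itself an element of the power, so linearity of the power
  -- compares it with `g`.
  <-or-≥ : ∀ f g k → AE (λ x → v f x + k < v g x) ⊎ AE (λ x → v g x ≤ v f x + k)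
  <-or-≥ f g k with IsStrictTotalOrder.compare Π-isSTO (shifted (+ k) f) g
  ... | tri< p _ _ = inj₁ (AE-map₂ (λ e → <-replaceˡ (sym e)) (v-shifted (+ k) f) (<⇒AE (shifted (+ k) f) g p))
  ... | tri≈ _ p _ = inj₂ (AE-map₂ (λ e q → ℕₚ.≤-reflexive (≡.trans (sym q) (sym e)))
                             (v-shifted (+ k) f) (≈⇒AE (shifted (+ k) f) g p))
  ... | tri> _ _ p = inj₂ (AE-map₂ (λ e q → ℕₚ.<⇒≤ (<-replaceʳ (sym e) q))
                             (v-shifted (+ k) f) (<⇒AE g (shifted (+ k) f) p))

  -- Excluded middle asks once whether some constant bounds the excess of `g` over `f`. If none
  -- does, `<-or-≥` has to choose its first alternative for every `k`.
  ≪-or-≳ : ∀ f g → f ≪ g ⊎ g ≲ f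
  ≪-or-≳ f g with em {g ≲ f}
  ... | yes g≲f = inj₂ g≲f
  ... | no ¬g≲f = inj₁ λ k → [ (λ p → p) , (λ p → ⊥-elim (¬g≲f (k , p))) ]′ (<-or-≥ f g k)

  ≪⇒⋧ : ∀ {f g} → f ≪ g → ¬ g ≲ f
  ≪⇒⋧ f≪g (k , g≤f+k) = AE-contradiction (λ ()) (AE-map₂ ℕₚ.<⇒≱ (f≪g k) g≤f+k)

  ≪⇒≲ : ∀ {f g} → f ≪ g → f ≲ g
  ≪⇒≲ f≪g = 0 , AE-map (λ p → ℕₚ.≤-trans (ℕₚ.m≤m+n _ 0) (ℕₚ.≤-trans (ℕₚ.<⇒≤ p) (ℕₚ.m≤m+n _ 0))) (f≪g 0)

  ≲-refl : ∀ {f g} → f ≈ g → f ≲ g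
  ≲-refl {f} {g} p = 0 , AE-map (λ e → ℕₚ.≤-trans (ℕₚ.≤-reflexive e) (ℕₚ.m≤m+n _ 0)) (≈⇒AE f g p)

  ≲-trans : ∀ {f g h} → f ≲ g → g ≲ h → f ≲ h
  ≲-trans {h = h} (k , p) (l , q) = l + k , AE-map₂
    (λ {x} p q → ℕₚ.≤-trans p (ℕₚ.≤-trans (ℕₚ.+-monoˡ-≤ k q) (ℕₚ.≤-reflexive (ℕₚ.+-assoc (v h x) l k)))) p q

  ≪-trans : ∀ {f g h} → f ≪ g → g ≪ h → f ≪ h
  ≪-trans p q k = AE-map₂ (λ p q → ℕₚ.<-trans p (ℕₚ.≤-<-trans (ℕₚ.m≤m+n _ 0) q)) (p k) (q 0)

  infix 4 _∼ᵇ_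

  _∼ᵇ_ : P → P → Set
  f ∼ᵇ g = f ≲ g × g ≲ f

  Blocks : Structure
  Blocks = record
    { Carrier = ∃ Nonstandard
    ; _≈_     = _∼ᵇ_ on proj₁
    ; _∼_     = _≪_ on proj₁
    }

  nonstandard-above : ∀ {f g} → Nonstandard f → f ≪ g → Nonstandard g
  nonstandard-above ns p k = AE-map₂ (λ p q → ℕₚ.<-trans p (ℕₚ.≤-<-trans (ℕₚ.m≤m+n _ 0) q)) (ns k) (p 0)

  standard≪ : ∀ {n f} → Nonstandard f → standard n ≪ f
  standard≪ {n} ns k = AE-map (λ p → <-replaceˡ (cong (λ m → m + k) (sym (v-standard n _))) p) (ns (n + k))

  -- Half of an infinite distance is infinite. Clearing `k` on either side of the midpoint uses the
  -- original distance at `k + k`, or at `suc (k + k)` above the midpoint because of rounding.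
  ≪-mid : ∀ f g → f ≪ g → let m = apply₂ {midpoint} midpoint-⇓ f g in f ≪ m × m ≪ g
  ≪-mid f g f≪g =
    (λ k → AE-map₂ (λ {x} e p → <-replaceʳ e
        (midpoint-> {v f x} {v g x} (midpoint-lower (v f x) (v g x)) {k} p))
      (v-apply₂ {midpoint} midpoint-⇓ f g) (f≪g (k + k))) ,
    (λ k → AE-map₂ (λ {x} e p → <-replaceˡ (cong (λ m → m + k) e)
        (midpoint-< {v f x} {v g x} (midpoint-lower (v f x) (v g x)) {k} (midpoint-upper (v f x) (v g x)) p))
      (v-apply₂ {midpoint} midpoint-⇓ f g) (f≪g (suc (k + k))))

  ≪-double : ∀ f → Nonstandard f → f ≪ apply₂ {_+_} add-⇓ f f
  ≪-double f ns k = AE-map₂ (λ e p → <-replaceʳ e (ℕₚ.+-monoʳ-< _ p)) (v-apply₂ {_+_} add-⇓ f f) (ns k)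

  -- Half of `f` is the midpoint of 0 and `f`: lying infinitely far above 0 makes it nonstandard,
  -- lying infinitely far below `f` makes its block smaller.
  ≪-half : ∀ f → Nonstandard f → ∃ λ g → Nonstandard g × g ≪ f
  ≪-half f ns with ≪-mid (standard 0) f (standard≪ {0} {f} ns)
  ... | 0≪g , g≪f = apply₂ {midpoint} midpoint-⇓ (standard 0) f ,
        (λ k → AE-map (λ p → <-replaceˡ (cong (λ m → m + k) (v-standard 0 _)) p) (0≪g k)) , g≪f

  identity : P
  identity = record { φ = proj zero ; range = λ _ → tt ; defined = AE-all λ _ → _ , ⇓proj }

  -- The only exceptions are the numbers up to `k`. This shows that `Blocks` is inhabited.
  identity-nonstandard : Nonstandard identity
  identity-nonstandard k = List.upTo (suc k) , λ {x} (_ , x≤k) →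
    ∈-upTo⁺ (s≤s (ℕₚ.≮⇒≥ λ k<x → x≤k (subst (k <_) (val-unique identity ⇓proj) k<x)))

  Blocks-isCountableDense : IsCountableDense Blocks
  Blocks-isCountableDense = record
    { isStrictTotalOrder = isStrictTotalOrderᶜ record
      { isEquivalence = record
        { refl  = λ {(f , _)} → ≲-refl {f} {f} (Eq.refl {f}) , ≲-refl {f} {f} (Eq.refl {f})
        ; sym   = λ (p , q) → q , p
        ; trans = λ {(f , _)} {(g , _)} {(h , _)} (p , q) (p′ , q′) →
            ≲-trans {f} {g} {h} p p′ , ≲-trans {h} {g} {f} q′ q
        }
      ; trans   = λ {(f , _)} {(g , _)} {(h , _)} → ≪-trans {f} {g} {h}
      ; compare = compare
      }
    ; dense = λ {(f , ns)} {(g , _)} p → let (l , r) = ≪-mid f g p in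
        (apply₂ {midpoint} midpoint-⇓ f g , nonstandard-above {f} ns l) , l , r
    ; noEndpoints = λ (f , ns) → let (g , ns′ , p) = ≪-half f ns in
        ((g , ns′) , p) ,
        ((apply₂ {_+_} add-⇓ f f , nonstandard-above {f} ns (≪-double f ns)) , ≪-double f ns)
    ; point = identity , identity-nonstandard
    ; code  = λ (f , _) → encode (φ f)
    ; code-injective = λ {(f , _)} {(g , _)} e →
        let f≈g = same f g (encode-injective (φ f) (φ g) e) in
        ≲-refl {f} {g} f≈g , ≲-refl {g} {f} (Eq.sym {f} {g} f≈g)
    }
    where
    open IsStrictTotalOrder Π-isSTO using (module Eq)
    same : ∀ f g → φ f ≡ φ g → f ≈ g
    same f g e = AE-map (λ (y , p) → y , p , subst (_[ _ ]⇓ y) e p) (defined f)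
    compare : ∀ f g → Tri (proj₁ f ≪ proj₁ g) (proj₁ f ∼ᵇ proj₁ g) (proj₁ g ≪ proj₁ f)
    compare (f , _) (g , _) with ≪-or-≳ f g | ≪-or-≳ g f
    ... | inj₁ f≪g | _        = tri< f≪g (λ (_ , p) → ≪⇒⋧ {f} {g} f≪g p)
                                     (λ p → ≪⇒⋧ {f} {g} f≪g (≪⇒≲ {g} {f} p))
    ... | inj₂ g≲f | inj₁ g≪f = tri> (λ p → ≪⇒⋧ {f} {g} p g≲f) (λ (p , _) → ≪⇒⋧ {g} {f} g≪f p) g≪f
    ... | inj₂ g≲f | inj₂ f≲g = tri≈ (λ p → ≪⇒⋧ {f} {g} p g≲f) (f≲g , g≲f) (λ p → ≪⇒⋧ {g} {f} p f≲g)

  -- Descent on `k`: comparison with the constant `k` gives equality, or the smaller bound `k - 1`,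
  -- and lying below the constant 0 is impossible.
  bounded⇒constant : ∀ k f → AE (λ x → v f x ≤ k) → ∃ λ n → AE (λ x → v f x ≡ n)
  bounded⇒constant k f f≤k with IsStrictTotalOrder.compare Π-isSTO f (standard k)
  ... | tri≈ _ p _ = k , AE-map (λ e → ≡.trans e (v-standard k _)) (≈⇒AE f (standard k) p)
  ... | tri> _ _ p = ⊥-elim (AE-contradiction (λ ()) (AE-map₂
          (λ q r → ℕₚ.<⇒≱ (<-replaceˡ (v-standard k _) q) r) (<⇒AE (standard k) f p) f≤k))
  bounded⇒constant zero    f f≤k | tri< p _ _ = ⊥-elim (AE-contradiction (λ ())
    (AE-map (λ q → <-replaceʳ (v-standard 0 _) q) (<⇒AE f (standard 0) p)))
  bounded⇒constant (suc k) f f≤k | tri< p _ _ = bounded⇒constant k f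
    (AE-map (λ q → ℕₚ.≤-pred (<-replaceʳ (v-standard (suc k) _) q)) (<⇒AE f (standard (suc k)) p))

  -- The difference `f + l - r` is an element of the power bounded by `k + l`, hence almost
  -- everywhere a constant `n`; the integer sought is `n - l`.
  ∼ᵇ⇒shifted : ∀ r f → r ∼ᵇ f → ∃ λ z → shifted z r ≈ f
  ∼ᵇ⇒shifted r f ((l , r≤f+l) , (k , f≤r+k)) with bounded⇒constant (k + l) d d≤
    where
    f+l d : P
    f+l = shifted (+ l) f
    d = apply₂ {λ x y → y ∸ x} sub-⇓ r f+l
    d≤ : AE (λ x → v d x ≤ k + l)
    d≤ = AE-map₃ (λ {x} e e′ p → ≤-replaceˡ e (ℕₚ.m≤n+o⇒m∸n≤o (v f+l x) (v r x)
        (≤-replaceˡ e′ (ℕₚ.≤-trans (ℕₚ.+-monoˡ-≤ l p) (ℕₚ.≤-reflexive (ℕₚ.+-assoc (v r x) k l))))))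
      (v-apply₂ {λ x y → y ∸ x} sub-⇓ r f+l) (v-shifted (+ l) f) f≤r+k
  ... | n , d≡n = n ℤ.⊖ l , AE⇒≈ (shifted (n ℤ.⊖ l) r) f (AE-map₂ (λ e e′ → ≡.trans (sym e) e′)
        (v-shifted (n ℤ.⊖ l) r)
        (AE-map₃ (λ {x} p e (e′ , e″) → shift-difference (v r x) {v f x} {l} p e e′ e″)
          r≤f+l (v-shifted (+ l) f)
          (AE-map₂ _,_ (v-apply₂ {λ x y → y ∸ x} sub-⇓ r (shifted (+ l) f)) d≡n)))

  ℚ-isCountableDense : IsCountableDense ℚ<
  ℚ-isCountableDense = record
    { isStrictTotalOrder = ℚₚ.<-isStrictTotalOrder
    ; dense              = ℚₚ.<-dense
    ; noEndpoints        = λ q →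
        (q ℚ.- ℚ.1ℚ , subst (q ℚ.- ℚ.1ℚ ℚ.<_) (ℚₚ.+-identityʳ q) (ℚₚ.+-monoʳ-< q -1<0)) ,
        (q ℚ.+ ℚ.1ℚ , subst (ℚ._< q ℚ.+ ℚ.1ℚ) (ℚₚ.+-identityʳ q) (ℚₚ.+-monoʳ-< q 0<1))
    ; point              = ℚ.0ℚ
    ; code               = λ q → pair (encode-ℤ (ℚ.numerator q)) (ℚ.denominator-1 q)
    ; code-injective     = λ {p} {q} e →
        mkℚ-≡ p q (encode-ℤ-injective (proj₁ (pair-injective e))) (proj₂ (pair-injective e))
    }
    where
    -1<0 : ℚ.- ℚ.1ℚ ℚ.< ℚ.0ℚ
    -1<0 = ℚ.*<* ℤ.-<+
    0<1 : ℚ.0ℚ ℚ.< ℚ.1ℚ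
    0<1 = ℚ.*<* (ℤ.+<+ (s≤s z≤n))
    encode-ℤ : ℤ → ℕ
    encode-ℤ (+ n)      = pair 0 n
    encode-ℤ (-[1+ n ]) = pair 1 n
    encode-ℤ-injective : ∀ {i j} → encode-ℤ i ≡ encode-ℤ j → i ≡ j
    encode-ℤ-injective { + m}       { + n}       e = cong +_ (proj₂ (pair-injective e))
    encode-ℤ-injective { -[1+ m ]}  { -[1+ n ]}  e = cong -[1+_] (proj₂ (pair-injective e))
    encode-ℤ-injective { + m}       { -[1+ n ]}  e with proj₁ (pair-injective e)
    ... | ()
    encode-ℤ-injective { -[1+ m ]}  { + n}       e with proj₁ (pair-injective e)
    ... | ()
    mkℚ-≡ : ∀ p q → ℚ.numerator p ≡ ℚ.numerator q → ℚ.denominator-1 p ≡ ℚ.denominator-1 q → p ≡ q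
    mkℚ-≡ (mkℚ _ _ _) (mkℚ _ _ _) = ℚₚ.mkℚ-cong

  private
    module R = IsOrderIsomorphism (proj₂ (cantor em ℚ-isCountableDense Blocks-isCountableDense))

    -- A representative of each block, the origin of its copy of `ℤ`. Since Cantor's isomorphism
    -- starts at `ℚ`, whose equality is propositional, each block receives a single origin without a
    -- further choice.
    block : ℚ → P
    block q = proj₁ (proj₁ (cantor em ℚ-isCountableDense Blocks-isCountableDense) q)

    block-nonstandard : ∀ q → Nonstandard (block q)
    block-nonstandard q = proj₂ (proj₁ (cantor em ℚ-isCountableDense Blocks-isCountableDense) q)

    embed : ℕ ⊎ (ℚ × ℤ) → P
    embed (inj₁ n)       = standard n
    embed (inj₂ (q , z)) = shifted z (block q)

    ≈-refl : ∀ f → f ≈ f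
    ≈-refl f = IsStrictTotalOrder.Eq.refl Π-isSTO {f}

    module Source = RawRelation (ℕ< ⊕ ℚ< ⊗ ℤ<)

    embed-cong : ∀ {s t} → s Source.≈ t → embed s ≈ embed t
    embed-cong (Sum.inj₁ {n} refl)                 = ≈-refl (standard n)
    embed-cong (Sum.inj₂ {q , z} (refl , refl)) = ≈-refl (shifted z (block q))

    embed-mono : ∀ {s t} → s Source.∼ t → embed s ∼ embed t
    embed-mono (₁∼₁ {m} {n} m<n) = AE⇒< (standard m) (standard n)
      (AE-all λ x → subst₂ _<_ (sym (v-standard m x)) (sym (v-standard n x)) m<n)
    -- The representative is taken above `n + ℤ.∣ z ∣`, since shifting by `z` lowers it by at most
    -- `ℤ.∣ z ∣`.
    embed-mono (₁∼₂ {n} {q , z}) = AE⇒< (standard n) (shifted z (block q))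
      (AE-map₂ (λ {x} e p → subst₂ _<_ (sym (v-standard n x)) e
          (ℕₚ.+-cancelʳ-< ℤ.∣ z ∣ _ _ (ℕₚ.<-≤-trans p (shift-lower z (v (block q) x)))))
        (v-shifted z (block q)) (block-nonstandard q (n + ℤ.∣ z ∣)))
    embed-mono (₂∼₂ {q , z} {q′ , z′} (inj₁ q<q′)) =
      AE⇒< (shifted z (block q)) (shifted z′ (block q′))
        (AE-map₃ (λ e e′ p → subst₂ _<_ e e′ (shift-mono-far z z′ p))
          (v-shifted z (block q)) (v-shifted z′ (block q′)) (R.mono q<q′ (ℤ.∣ z ∣ + ℤ.∣ z′ ∣)))
    embed-mono (₂∼₂ {q , z} {.q , z′} (inj₂ (refl , z<z′))) =
      AE⇒< (shifted z (block q)) (shifted z′ (block q))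
        (AE-map₃ (λ e e′ p → subst₂ _<_ e e′ (shift-mono-ℤ z<z′ p))
          (v-shifted z (block q)) (v-shifted z′ (block q)) (block-nonstandard q ℤ.∣ z ∣))

    embed-standard : ∀ f → f ≲ standard 0 → ∃ λ s → embed s ≈ f
    embed-standard f (k , f≤0+k) = inj₁ (proj₁ constantly-n) ,
      AE⇒≈ (standard (proj₁ constantly-n)) f
        (AE-map (λ e → ≡.trans (v-standard _ _) (sym e)) (proj₂ constantly-n))
      where
      constantly-n : ∃ λ n → AE (λ x → v f x ≡ n)
      constantly-n = bounded⇒constant k f
        (AE-map (λ p → ℕₚ.≤-trans p (ℕₚ.≤-reflexive (cong (λ m → m + k) (v-standard 0 _)))) f≤0+k)

    -- Surjectivity onto `Blocks` reaches `f` only up to a finite distance, which `∼ᵇ⇒shifted` turns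
    -- into the integer coordinate.
    embed-nonstandard : ∀ f → standard 0 ≪ f → ∃ λ s → embed s ≈ f
    embed-nonstandard f 0≪f = inj₂ (proj₁ nearest , proj₁ offset) , proj₂ offset
      where
      ns : Nonstandard f
      ns k = AE-map (λ p → <-replaceˡ (cong (λ m → m + k) (v-standard 0 _)) p) (0≪f k)
      nearest : ∃ λ q → ∀ {p} → p ≡ q → block p ∼ᵇ f
      nearest = R.surjective (f , ns)
      offset : ∃ λ z → shifted z (block (proj₁ nearest)) ≈ f
      offset = ∼ᵇ⇒shifted (block (proj₁ nearest)) f (proj₂ nearest refl)

    embed-onto : ∀ f → ∃ λ s → embed s ≈ f
    embed-onto f = [ embed-nonstandard f , embed-standard f ]′ (≪-or-≳ (standard 0) f)

  source-isSTO : IsSTO (ℕ< ⊕ ℚ< ⊗ ℤ<)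
  source-isSTO = ⊎-<-isStrictTotalOrder ℕₚ.<-isStrictTotalOrder
    (×-isStrictTotalOrder ℚₚ.<-isStrictTotalOrder ℤₚ.<-isStrictTotalOrder)

  Π-ℕω : ℕ< ⊕ ℚ< ⊗ ℤ< ≅ Π C ℕω
  Π-ℕω = ≅-intro source-isSTO Π-isSPO embed embed-cong embed-mono embed-onto

-- Transfer to presentations with computable successor

≅-trans : {A B C : Structure} → IsSPO C → A ≅ B → B ≅ C → A ≅ C
≅-trans isSPO-C (f , f-iso) (g , g-iso) = _ ,
  Composition.isOrderIsomorphism (IsStrictPartialOrder.Eq.trans isSPO-C) f-iso g-iso

-- Iterating the successor from the least element enumerates the order, and
-- searching through this enumeration inverts it.
module Presentation (A : ComputableLinearOrder) (A≅ℕ : ⌊ order A ⌋ ≅ ℕ<)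
  (successor : ComputableSuccessor (order A)) where
  private
    module A = ComputableLinearOrder A
    module I = IsOrderIsomorphism (proj₂ A≅ℕ)

  position : ∃ (dom A.order) → ℕ
  position = proj₁ A≅ℕ

  element : ℕ → ∃ (dom A.order)
  element n = proj₁ (I.surjective n)

  position-element : ∀ n → position (element n) ≡ n
  position-element n = proj₂ (I.surjective n) {element n} refl

  element-position : ∀ a → proj₁ (element (position a)) ≡ proj₁ a
  element-position a = I.injective {element (position a)} {a} (position-element (position a))

  element-mono : ∀ {m n} → m < n → lt A.order (proj₁ (element m)) (proj₁ (element n))
  element-mono {m} {n} m<n = I.cancel {element m} {element n}
    (subst₂ _<_ (sym (position-element m)) (sym (position-element n)) m<n)

  private
    s : Rec 1
    s = proj₁ successor

    -- A position beyond `suc n` would leave `element (suc n)` strictly between, and one below it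
    -- would contradict that `y` lies above `element n`.
    successor-position : ∀ n {y} → ImmediateSuccessor ⌊ A.order ⌋ (element n) y → position y ≡ suc n
    successor-position n {y} (x<y , gap) with ℕₚ.<-cmp (suc n) (position y)
    ... | tri< n+1<y _ _ = ⊥-elim (gap (element (suc n)) (element-mono (ℕₚ.n<1+n n) ,
            I.cancel {element (suc n)} {y} (<-replaceˡ (sym (position-element (suc n))) n+1<y)))
    ... | tri≈ _ e _     = sym e
    ... | tri> _ _ y<n+1 = ⊥-elim (ℕₚ.<⇒≱ (<-replaceˡ (position-element n) (I.mono {element n} {y} x<y))
                                          (ℕₚ.≤-pred y<n+1))

    successor-⇓ : ∀ n → s [ proj₁ (element n) ∷ [] ]⇓ proj₁ (element (suc n))
    successor-⇓ n with proj₂ successor (element n)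
    ... | y , p , isSuccessor = subst (s [ _ ]⇓_)
          (I.injective {y} {element (suc n)}
            (≡.trans (successor-position n {y} isSuccessor) (sym (position-element (suc n))))) p

    element-rec : Rec 1
    -- The least element is a single number and is built into the program as a constant.
    element-rec = prec (proj₁ (constant (proj₁ (element 0)))) (comp s (proj (suc zero) ∷ []))

    element-⇓ : ∀ n → element-rec [ n ∷ [] ]⇓ proj₁ (element n)
    element-⇓ zero    = ⇓prec₀ (proj₂ (constant (proj₁ (element 0))) [])
    element-⇓ (suc n) = ⇓precₛ (element-⇓ n) (⇓comp (⇓proj ∷ []) (successor-⇓ n))

    search : Recursive {2} (λ xs → dist (proj₁ (element (lookup xs zero))) (lookup xs (suc zero)))
    search = ⟨dist⟩ (lift₁ (λ n → proj₁ (element n)) element-⇓ (var zero)) (var (suc zero))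

    -- The enumeration does not repeat itself, so no earlier index yields `a`, and the unbounded
    -- search returns exactly its position.
    position-least : ∀ a → LeastZero (λ n → dist (proj₁ (element n)) (proj₁ a)) (position a)
    position-least a =
      ≡.trans (cong (λ b → dist b (proj₁ a)) (element-position a)) (dist-refl (proj₁ a)) , earlier
      where
      earlier : ∀ {n} → n < position a → ∃ λ k → dist (proj₁ (element n)) (proj₁ a) ≡ suc k
      earlier {n} n<a with dist (proj₁ (element n)) (proj₁ a) in e
      ... | suc k = k , refl
      ... | zero  = ⊥-elim (ℕₚ.<-irrefl (≡.trans (sym (position-element n))
              (I.cong {element n} {a} (dist≡0⇒≡ _ _ e))) n<a)

  module _ (em : ExcludedMiddle 0ℓ) (pairing : ComputablePairing) (C : Pred ℕ 0ℓ) (cohesive : Cohesive C) where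
    open Power em C cohesive
    private
      O = linear-isPointedOrder A
      Oℕ = linear-isPointedOrder ℕ-linear
      module ΠA = Linear A
      module Πℕ = ℕPower em pairing C cohesive

      enumerate : ∃ (dom ℕω) → ∃ (dom A.order)
      enumerate (n , _) = element n

      locate : ∃ (dom A.order) → ∃ (dom ℕω)
      locate a = position a , tt

      enumerate-⇓ : Implements₁ ℕω A.order element-rec enumerate
      enumerate-⇓ (n , _) = element-⇓ n

      locate-⇓ : Implements₁ A.order ℕω (mu (proj₁ search)) locate
      locate-⇓ a = mu-⇓ search (position-least a)

      onto : ∀ f → ∃ λ g → map₁ Oℕ O enumerate enumerate-⇓ g ΠA.≈ f
      onto f = g , ΠA.AE⇒≈ (map₁ Oℕ O enumerate enumerate-⇓ g) f
        (AE-map₂ (λ {x} e e′ → ≡.trans (sym e)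
            (≡.trans (cong (λ n → proj₁ (element n)) (sym e′)) (element-position (ΠA.val f x))))
          (val-map₁ Oℕ O enumerate enumerate-⇓ g) (val-map₁ O Oℕ locate locate-⇓ f))
        where g = map₁ O Oℕ locate locate-⇓ f

      Πℕ≅ΠA : Π C ℕω ≅ Π C A.order
      Πℕ≅ΠA = ≅-intro Πℕ.Π-isSTO ΠA.Π-isSPO (map₁ Oℕ O enumerate enumerate-⇓)
        (λ {f} {g} → map₁-cong Oℕ O enumerate enumerate-⇓ f g)
        (λ {f} {g} → map₁-mono Oℕ O enumerate enumerate-⇓ (λ _ _ → element-mono) f g)
        onto

    Π-presentation : Π C A.order ≅ ℕ< ⊕ ℚ< ⊗ ℤ<
    Π-presentation = ≅-sym Πℕ.source-isSTO ΠA.Π-isSPO (≅-trans ΠA.Π-isSPO Πℕ.Π-ℕω Πℕ≅ΠA)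

theorem6 : ExcludedMiddle 0ℓ →
  (pairing : ComputablePairing) → let open Coded pairing in
  (L₀ L₁ : ComputableLinearOrder) (C : Pred ℕ 0ℓ) → Cohesive C →
    (Π C (order L₀ +ω order L₁) ≅ Π C (order L₀) ⊕ Π C (order L₁))
  × (Π C (order L₀ ×ω order L₁) ≅ Π C (order L₀) ⊗ Π C (order L₁))
  × (Π C (revω (order L₀)) ≅ rev (Π C (order L₀)))
  × ((A : ComputableLinearOrder) → ⌊ order A ⌋ ≅ ℕ< → ComputableSuccessor (order A) →
       Π C (order A) ≅ ℕ< ⊕ ℚ< ⊗ ℤ<)
  × ((L : ComputableLinearOrder) → DenseWithoutEndpoints (order L) →
       ⌊ order L ⌋ ≅ Π C (order L))
theorem6 em pairing L₀ L₁ C cohesive =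
    Π-sum , Π-product , Π-reverse (order L₀) C ,
    (λ A A≅ℕ successor → Presentation.Π-presentation A A≅ℕ successor em pairing C cohesive) ,
    (λ L dwe → DensePower.Π-dense em pairing L dwe C cohesive)
  where open SumAndProduct em pairing L₀ L₁ C cohesive
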